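{- For every sufficiently small constant $\varepsilon>0$, sample-based learning of convex sets in $\{0,\pm1\}^n$ requires at least $3^{\Omega(\sqrt n)}$ samples. That is, there is $\varepsilon_0>0$ such that for every $\varepsilon\in(0,\varepsilon_0]$ there exist $c>0$ and $n_0$ such that for all $n\ge n_0$ every sample-based learning algorithm for convex sets in $\{0,\pm1\}^n$ with error parameter $\varepsilon$ uses at least $3^{c\sqrt n}$ samples.
   Context: A set $S\subseteq\{0,\pm1\}^n$ is convex if $S=\mathrm{Conv}(S)\cap\{0,\pm1\}^n$, where $\mathrm{Conv}(S)\subseteq\mathbb{R}^n$ is the convex hull. For $S,T\subseteq\{0,\pm1\}^n$, $\mathrm{dist}(S,T)=|S\,\Delta\,T|/3^n$. A sample-based learning algorithm for convex sets with error parameter $\varepsilon$ receives labelled examples $(x,\mathbf 1[x\in S])$ of an unknown convex set $S\subseteq\{0,\pm1\}^n$, with the points $x$ independent and uniform in $\{0,\pm1\}^n$, and must output, with probability at least $2/3$, a set $T\subseteq\{0,\pm1\}^n$ (not necessarily convex) with $\mathrm{dist}(S,T)<\varepsilon$. -}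

module Defs where

open import Data.Bool.Base using (Bool; if_then_else_; T; _xor_)
open import Data.Integer.Base using (+_)
open import Data.List.Base as List using (List; []; _∷_)
open import Data.Nat.Base as ℕ using (ℕ; zero; suc; _⊔_)
import Data.Nat.Properties as ℕₚ
open import Data.Product.Base using (Σ-syntax; ∃-syntax; _×_; _,_)
open import Data.Rational.Base as ℚ using (ℚ; 0ℚ; 1ℚ; ½; _/_; ∣_∣)
import Data.Rational.Properties as ℚₚ
open import Data.Rational.Solver using (module +-*-Solver)
open import Data.Vec.Base as Vec using (Vec; []; _∷_)
open import Data.Vec.Functional as Vector using (Vector)
open import Function.Bundles using (_⇔_)
open import Relation.Binary.PropositionalEquality using (_≡_; refl; sym; trans; cong; subst)
open import Relation.Unary using (Pred; _∈_)
open import Level using (0ℓ)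

-- Real numbers: rational Cauchy sequences with a modulus of convergence.
-- Equality is the equivalence _≈_; all operations are pointwise.

Eventually : (ℕ → Set) → Set
Eventually P = ∃[ N ] (∀ k → N ℕ.≤ k → P k)

Cauchy : (ℕ → ℚ) → Set
Cauchy s = ∀ δ → 0ℚ ℚ.< δ →
  ∃[ N ] (∀ j k → N ℕ.≤ j → N ℕ.≤ k → ∣ s j ℚ.- s k ∣ ℚ.≤ δ)

record ℝ : Set where
  constructor mkℝ
  field
    seq    : ℕ → ℚ
    cauchy : Cauchy seq

open ℝ public

infix  4 _≤_ _<_ _≈_
infixl 6 _+_
infixl 7 _*_

_≤_ _<_ _≈_ : ℝ → ℝ → Set
x ≤ y = ∀ δ → 0ℚ ℚ.< δ → Eventually (λ k → seq x k ℚ.≤ seq y k ℚ.+ δ)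
x < y = ∃[ δ ] 0ℚ ℚ.< δ × Eventually (λ k → seq x k ℚ.+ δ ℚ.≤ seq y k)
x ≈ y = x ≤ y × y ≤ x

fromℚ : ℚ → ℝ
fromℚ q .seq _ = q
fromℚ q .cauchy δ 0<δ = 0 , λ _ _ _ _ →
  subst (λ r → ∣ r ∣ ℚ.≤ δ) (sym (ℚₚ.+-inverseʳ q)) (ℚₚ.<⇒≤ 0<δ)

0ℝ 1ℝ : ℝ
0ℝ = fromℚ 0ℚ
1ℝ = fromℚ 1ℚ

private
  half>0 : ∀ {δ} → 0ℚ ℚ.< δ → 0ℚ ℚ.< ½ ℚ.* δ
  half>0 0<δ = ℚₚ.*-monoʳ-<-pos ½ 0<δ

  half+half : ∀ δ → ½ ℚ.* δ ℚ.+ ½ ℚ.* δ ≡ δ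
  half+half δ = trans (sym (ℚₚ.*-distribʳ-+ δ ½ ½)) (ℚₚ.*-identityˡ δ)

  +-cauchy : ∀ {s t} → Cauchy s → Cauchy t → Cauchy (λ k → s k ℚ.+ t k)
  +-cauchy {s} {t} cs ct δ 0<δ
    with cs (½ ℚ.* δ) (half>0 0<δ) | ct (½ ℚ.* δ) (half>0 0<δ)
  ... | M , p | N , q = M ⊔ N , λ j k j≥ k≥ → begin
    ∣ (s j ℚ.+ t j) ℚ.- (s k ℚ.+ t k) ∣
      ≡⟨ cong ∣_∣ (rearrange (s j) (t j) (s k) (t k)) ⟩
    ∣ (s j ℚ.- s k) ℚ.+ (t j ℚ.- t k) ∣
      ≤⟨ ℚₚ.∣p+q∣≤∣p∣+∣q∣ (s j ℚ.- s k) (t j ℚ.- t k) ⟩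
    ∣ s j ℚ.- s k ∣ ℚ.+ ∣ t j ℚ.- t k ∣
      ≤⟨ ℚₚ.+-mono-≤ (p j k (ℕₚ.m⊔n≤o⇒m≤o M N j≥) (ℕₚ.m⊔n≤o⇒m≤o M N k≥))
                     (q j k (ℕₚ.m⊔n≤o⇒n≤o M N j≥) (ℕₚ.m⊔n≤o⇒n≤o M N k≥)) ⟩
    ½ ℚ.* δ ℚ.+ ½ ℚ.* δ
      ≡⟨ half+half δ ⟩
    δ ∎
    where
    open ℚₚ.≤-Reasoning
    open +-*-Solver
    rearrange : ∀ a b c d → (a ℚ.+ b) ℚ.- (c ℚ.+ d) ≡ (a ℚ.- c) ℚ.+ (b ℚ.- d)
    rearrange = solve 4 (λ a b c d → (a :+ b) :- (c :+ d) := (a :- c) :+ (b :- d)) refl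

  bound : ∀ {s} → Cauchy s →
    ∃[ B ] 0ℚ ℚ.< B × Eventually (λ k → ∣ s k ∣ ℚ.≤ B)
  bound {s} cs with cs 1ℚ (ℚₚ.positive⁻¹ 1ℚ)
  ... | N , p =
    1ℚ ℚ.+ ∣ s N ∣ , ℚₚ.+-mono-<-≤ (ℚₚ.positive⁻¹ 1ℚ) (ℚₚ.0≤∣p∣ (s N)) ,
    N , λ k N≤k → begin
      ∣ s k ∣                        ≡⟨ cong ∣_∣ (insert (s k) (s N)) ⟩
      ∣ (s k ℚ.- s N) ℚ.+ s N ∣      ≤⟨ ℚₚ.∣p+q∣≤∣p∣+∣q∣ (s k ℚ.- s N) (s N) ⟩
      ∣ s k ℚ.- s N ∣ ℚ.+ ∣ s N ∣    ≤⟨ ℚₚ.+-monoˡ-≤ ∣ s N ∣ (p k N N≤k ℕₚ.≤-refl) ⟩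
      1ℚ ℚ.+ ∣ s N ∣                 ∎
    where
    open ℚₚ.≤-Reasoning
    open +-*-Solver
    insert : ∀ a b → a ≡ (a ℚ.- b) ℚ.+ b
    insert = solve 2 (λ a b → a := (a :- b) :+ b) refl

  *-mono-∣∣ : ∀ p q {a b} → 0ℚ ℚ.< a → ∣ p ∣ ℚ.≤ a → ∣ q ∣ ℚ.≤ b →
    ∣ p ℚ.* q ∣ ℚ.≤ a ℚ.* b
  *-mono-∣∣ p q {a} {b} 0<a p≤a q≤b = begin
    ∣ p ℚ.* q ∣        ≡⟨ ℚₚ.∣p*q∣≡∣p∣*∣q∣ p q ⟩
    ∣ p ∣ ℚ.* ∣ q ∣    ≤⟨ ℚₚ.*-monoʳ-≤-nonNeg ∣ q ∣ {{ℚₚ.∣-∣-nonNeg q}} p≤a ⟩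
    a ℚ.* ∣ q ∣        ≤⟨ ℚₚ.*-monoˡ-≤-nonNeg a {{ℚ.nonNegative (ℚₚ.<⇒≤ 0<a)}} q≤b ⟩
    a ℚ.* b            ∎
    where open ℚₚ.≤-Reasoning

  divide : ∀ C δ → 0ℚ ℚ.< C → 0ℚ ℚ.< δ → ∃[ η ] 0ℚ ℚ.< η × C ℚ.* η ≡ δ
  divide C δ 0<C 0<δ = ℚ.1/ C ℚ.* δ , 0<η , Cη≡δ
    where
    instance
      C-pos : ℚ.Positive C
      C-pos = ℚ.positive 0<C
      C-nonZero : ℚ.NonZero C
      C-nonZero = ℚₚ.pos⇒nonZero C
    0<η : 0ℚ ℚ.< ℚ.1/ C ℚ.* δ
    0<η = subst (ℚ._< ℚ.1/ C ℚ.* δ) (ℚₚ.*-zeroʳ (ℚ.1/ C))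
      (ℚₚ.*-monoʳ-<-pos (ℚ.1/ C) {{ℚₚ.1/pos⇒pos C}} 0<δ)
    Cη≡δ : C ℚ.* (ℚ.1/ C ℚ.* δ) ≡ δ
    Cη≡δ = trans (sym (ℚₚ.*-assoc C (ℚ.1/ C) δ))
      (trans (cong (ℚ._* δ) (ℚₚ.*-inverseʳ C)) (ℚₚ.*-identityˡ δ))

  *-difference : ∀ {A B η} a b c d → 0ℚ ℚ.< A → 0ℚ ℚ.< B →
    ∣ a ∣ ℚ.≤ A → ∣ d ∣ ℚ.≤ B → ∣ a ℚ.- c ∣ ℚ.≤ η → ∣ b ℚ.- d ∣ ℚ.≤ η →
    ∣ a ℚ.* b ℚ.- c ℚ.* d ∣ ℚ.≤ (A ℚ.+ B) ℚ.* η
  *-difference {A} {B} {η} a b c d 0<A 0<B a≤A d≤B a-c≤η b-d≤η = begin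
    ∣ a ℚ.* b ℚ.- c ℚ.* d ∣
      ≡⟨ cong ∣_∣ (split a b c d) ⟩
    ∣ a ℚ.* (b ℚ.- d) ℚ.+ d ℚ.* (a ℚ.- c) ∣
      ≤⟨ ℚₚ.∣p+q∣≤∣p∣+∣q∣ (a ℚ.* (b ℚ.- d)) (d ℚ.* (a ℚ.- c)) ⟩
    ∣ a ℚ.* (b ℚ.- d) ∣ ℚ.+ ∣ d ℚ.* (a ℚ.- c) ∣
      ≤⟨ ℚₚ.+-mono-≤ (*-mono-∣∣ a (b ℚ.- d) 0<A a≤A b-d≤η)
                     (*-mono-∣∣ d (a ℚ.- c) 0<B d≤B a-c≤η) ⟩
    A ℚ.* η ℚ.+ B ℚ.* η
      ≡⟨ sym (ℚₚ.*-distribʳ-+ η A B) ⟩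
    (A ℚ.+ B) ℚ.* η ∎
    where
    open ℚₚ.≤-Reasoning
    open +-*-Solver
    split : ∀ a b c d → a ℚ.* b ℚ.- c ℚ.* d ≡ a ℚ.* (b ℚ.- d) ℚ.+ d ℚ.* (a ℚ.- c)
    split = solve 4 (λ a b c d → a :* b :- c :* d := a :* (b :- d) :+ d :* (a :- c)) refl

  *-cauchy : ∀ {s t} → Cauchy s → Cauchy t → Cauchy (λ k → s k ℚ.* t k)
  *-cauchy {s} {t} cs ct δ 0<δ =
    let A , 0<A , K , s≤A = bound cs
        B , 0<B , L , t≤B = bound ct
        η , 0<η , Cη≡δ = divide (A ℚ.+ B) δ (ℚₚ.+-mono-< 0<A 0<B) 0<δ
        M , p = cs η 0<η
        N , q = ct η 0<η
    in (K ⊔ L) ⊔ (M ⊔ N) , λ j k j≥ k≥ →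
      let j₁ = ℕₚ.m⊔n≤o⇒m≤o (K ⊔ L) (M ⊔ N) j≥
          j₂ = ℕₚ.m⊔n≤o⇒n≤o (K ⊔ L) (M ⊔ N) j≥
          k₁ = ℕₚ.m⊔n≤o⇒m≤o (K ⊔ L) (M ⊔ N) k≥
          k₂ = ℕₚ.m⊔n≤o⇒n≤o (K ⊔ L) (M ⊔ N) k≥
      in ℚₚ.≤-trans
        (*-difference (s j) (t j) (s k) (t k) 0<A 0<B
          (s≤A j (ℕₚ.m⊔n≤o⇒m≤o K L j₁)) (t≤B k (ℕₚ.m⊔n≤o⇒n≤o K L k₁))
          (p j k (ℕₚ.m⊔n≤o⇒m≤o M N j₂) (ℕₚ.m⊔n≤o⇒m≤o M N k₂))
          (q j k (ℕₚ.m⊔n≤o⇒n≤o M N j₂) (ℕₚ.m⊔n≤o⇒n≤o M N k₂)))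
        (ℚₚ.≤-reflexive Cη≡δ)

_+_ _*_ : ℝ → ℝ → ℝ
(x + y) .seq k  = seq x k ℚ.+ seq y k
(x + y) .cauchy = +-cauchy {seq x} {seq y} (cauchy x) (cauchy y)
(x * y) .seq k  = seq x k ℚ.* seq y k
(x * y) .cauchy = *-cauchy {seq x} {seq y} (cauchy x) (cauchy y)

sum : ∀ {k} → Vector ℝ k → ℝ
sum = Vector.foldr _+_ 0ℝ

-- m ≥3^ c √ n means m ≥ 3^(c√n), for c ≥ 0.  The real power is the supremum of
-- the rational powers 3^(a/b) with 0 ≤ a/b ≤ c√n, i.e. (a/b)² ≤ c²n, and
-- 3^(a/b) ≤ m means 3^a ≤ m^b; here b is suc b.
_≥3^_√_ : ℕ → ℝ → ℕ → Set
m ≥3^ c √ n = ∀ (a b : ℕ) →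
  let r = fromℚ (+ a / suc b) in
  r * r ≤ c * c * fromℚ (+ n / 1) → 3 ℕ.^ a ℕ.≤ m ℕ.^ suc b

record IsWeighting {k} (w : Vector ℝ k) : Set where
  field
    nonNegative : ∀ i → 0ℝ ≤ w i
    total       : sum w ≈ 1ℝ

Conv : ∀ {n} → Pred (Vector ℝ n) 0ℓ → Pred (Vector ℝ n) 0ℓ
Conv {n} P v = ∃[ k ] Σ[ w ∈ Vector ℝ k ] Σ[ p ∈ Vector (Vector ℝ n) k ]
  IsWeighting w × (∀ j → p j ∈ P) × (∀ i → v i ≈ sum (λ j → w j * p j i))

data Trit : Set where
  -1ₜ 0ₜ 1ₜ : Trit

tritℝ : Trit → ℝ
tritℝ -1ₜ = fromℚ (ℚ.- 1ℚ)
tritℝ 0ₜ  = 0ℝ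
tritℝ 1ₜ  = 1ℝ

Point : ℕ → Set
Point n = Vec Trit n

embed : ∀ {n} → Point n → Vector ℝ n
embed x i = tritℝ (Vec.lookup x i)

-- Subsets are given by their indicator functions, which also supply the labels.
Subset : ℕ → Set
Subset n = Point n → Bool

image : ∀ {n} → Subset n → Pred (Vector ℝ n) 0ℓ
image S v = ∃[ x ] T (S x) × (∀ i → v i ≈ embed x i)

Convex : ∀ {n} → Subset n → Set
Convex S = ∀ x → T (S x) ⇔ embed x ∈ Conv (image S)

vectors : ∀ {A : Set} → List A → (k : ℕ) → List (Vec A k)
vectors xs zero    = [] ∷ []
vectors xs (suc k) = List.cartesianProductWith _∷_ xs (vectors xs k)

points : (n : ℕ) → List (Point n)
points = vectors (-1ₜ ∷ 0ₜ ∷ 1ₜ ∷ [])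

dist : ∀ {n} → Subset n → Subset n → ℚ
dist {n} S U =
  (+ List.length (List.filterᵇ (λ x → S x xor U x) (points n)) / 3 ℕ.^ n)
    {{ℕₚ.m^n≢0 3 n}}

record Distribution (A : Set) : Set where
  field
    size        : ℕ
    weight      : Vector ℝ size
    outcome     : Vector A size
    isWeighting : IsWeighting weight

prob : ∀ {A : Set} → Distribution A → (A → Bool) → ℝ
prob μ E = sum (λ i → if E (outcome i) then weight i else 0ℝ)
  where open Distribution μ

-- A randomised algorithm using m labelled examples: each possible sequence of
-- examples determines a distribution of hypotheses.
Learner : (n m : ℕ) → Set
Learner n m = Vec (Point n × Bool) m → Distribution (Subset n)

label : ∀ {n m} → Subset n → Vec (Point n) m → Vec (Point n × Bool) m
label S = Vec.map (λ x → x , S x)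

-- The probability, over m independent uniform points labelled by S and the
-- randomness of the learner, that the output satisfies E.
outputProb : ∀ {n m} → Learner n m → Subset n → (Subset n → Bool) → ℝ
outputProb {n} {m} L S E =
  fromℚ ((+ 1 / (3 ℕ.^ n) ℕ.^ m) {{nz}}) *
  List.foldr _+_ 0ℝ
    (List.map (λ xs → prob (L (label S xs)) E) (vectors (points n) m))
  where
  nz : ℕ.NonZero ((3 ℕ.^ n) ℕ.^ m)
  nz = ℕₚ.m^n≢0 (3 ℕ.^ n) m {{ℕₚ.m^n≢0 3 n}}

-- For real ε the event dist S U < ε need not be decidable.  Its probability is
-- at least 2/3 when that holds for every decidable event E containing it
-- (classically, the event itself is the least such E).
Learns : ∀ {n m} → ℝ → Learner n m → Set
Learns {n} ε L = ∀ S → Convex S → ∀ (E : Subset n → Bool) →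
  (∀ U → fromℚ (dist S U) < ε → T (E U)) →
  fromℚ (+ 2 / 3) ≤ outputProb L S E

-- A term is a set A of coordinates; a point satisfies it when all its coordinates
-- in A equal 1, which is a halfspace condition, so removing from the cube all points
-- that satisfy some term of a given list leaves a convex set.  Take w ≈ √n / 2
-- coordinates, one from each of w blocks of size 4w: two random such terms share few
-- coordinates, so 3^(w-2) terms can be chosen greedily with so little overlap that a
-- constant fraction of the points satisfies exactly one of them.  Each subset of the
-- terms gives a concept.  As a term is satisfied with probability 3^(-w), a learner
-- with fewer than 3^w / 6 samples misses most terms; on the points satisfying only a
-- missed term its output agrees with the concept with probability 1/2 on average
-- over the concepts, which is too little for a success probability of 2/3.

module Submission where

-- Two terms of size w with k common coordinates are jointly satisfied by a fraction 3^(k - 2w) of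
-- the points, so the quantity to control is the mean of 3^k. With one random coordinate per block
-- of length q the blocks are independent and this mean is (1 + 2/q)^w. It stays bounded only if q
-- grows like w, hence w blocks of length 4w, and w of order √n.
--
-- With 3^(w-2) terms a point satisfies 1/9 of a term on average, and the mean number of satisfied
-- pairs is at most 2/81, so at least 1/9 - 4/81 = 5/81 of the points satisfy exactly one term. The
-- choice of 1/243 as largest ε lets a successful hypothesis err on at most 1/12 as many points as
-- these. Averaging the agreement on them gives 2/3 ≤ 1/2 + m/(2·3^w) + 1/12, that is 3^w ≤ 6m.
--
-- The obstacle is that the learner's probabilities are Cauchy reals, without decidable order. So
-- nothing is divided or subtracted: averages are sums over all concepts, samples and points,
-- cleared of denominators, and the final inequality between multiples of 1 is read back in ℕ.

open import Algebra.Bundles using (CommutativeMonoid)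

-- Finite sums over lists in a commutative monoid, for use in ℕ and for sequences

module ListSum {c ℓ} (M : CommutativeMonoid c ℓ) where
  open import Data.Bool.Base using (Bool; true; false; not)
  open import Data.Fin.Base using (Fin; zero; suc)
  open import Data.List.Base
  open import Data.Nat.Base using (ℕ)
  import Data.Vec.Base as Vec
  open import Defs using (vectors)
  open CommutativeMonoid M renaming (_∙_ to _+_; ε to 0#; ∙-cong to +-cong; ∙-congˡ to +-congˡ)
  open import Algebra.Properties.CommutativeMonoid.Mult M using (_×_)
  open import Algebra.Properties.CommutativeSemigroup commutativeSemigroup using (interchange; x∙yz≈y∙xz)
  open import Relation.Binary.Reasoning.Setoid setoid

  private variable
    A B C : Set

  ∑ : List A → (A → Carrier) → Carrier
  ∑ xs f = foldr _+_ 0# (map f xs)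

  ∑-cong : ∀ (xs : List A) {f g} → (∀ x → f x ≈ g x) → ∑ xs f ≈ ∑ xs g
  ∑-cong []       f≈g = refl
  ∑-cong (x ∷ xs) f≈g = +-cong (f≈g x) (∑-cong xs f≈g)

  ∑-distrib-+ : ∀ (xs : List A) f g → ∑ xs (λ x → f x + g x) ≈ ∑ xs f + ∑ xs g
  ∑-distrib-+ []       f g = sym (identityˡ 0#)
  ∑-distrib-+ (x ∷ xs) f g = begin
    (f x + g x) + ∑ xs (λ x → f x + g x)  ≈⟨ +-congˡ (∑-distrib-+ xs f g) ⟩
    (f x + g x) + (∑ xs f + ∑ xs g)       ≈⟨ interchange _ _ _ _ ⟩
    (f x + ∑ xs f) + (g x + ∑ xs g)       ∎

  ∑-const : ∀ (xs : List A) c → ∑ xs (λ _ → c) ≈ length xs × c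
  ∑-const []       c = refl
  ∑-const (x ∷ xs) c = +-congˡ (∑-const xs c)

  ∑-zero : ∀ (xs : List A) → ∑ xs (λ _ → 0#) ≈ 0#
  ∑-zero []       = refl
  ∑-zero (x ∷ xs) = trans (identityˡ _) (∑-zero xs)

  ∑-comm : ∀ (xs : List A) (ys : List B) (f : A → B → Carrier) →
    ∑ xs (λ x → ∑ ys (f x)) ≈ ∑ ys (λ y → ∑ xs (λ x → f x y))
  ∑-comm []       ys f = sym (∑-zero ys)
  ∑-comm (x ∷ xs) ys f = begin
    ∑ ys (f x) + ∑ xs (λ x → ∑ ys (f x))             ≈⟨ +-congˡ (∑-comm xs ys f) ⟩
    ∑ ys (f x) + ∑ ys (λ y → ∑ xs (λ x → f x y))     ≈⟨ ∑-distrib-+ ys (f x) _ ⟨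
    ∑ ys (λ y → f x y + ∑ xs (λ x → f x y))          ∎

  ∑-++ : ∀ (xs ys : List A) f → ∑ (xs ++ ys) f ≈ ∑ xs f + ∑ ys f
  ∑-++ []       ys f = sym (identityˡ _)
  ∑-++ (x ∷ xs) ys f = trans (+-congˡ (∑-++ xs ys f)) (sym (assoc _ _ _))

  ∑-map : ∀ (g : A → B) xs f → ∑ (map g xs) f ≈ ∑ xs (λ x → f (g x))
  ∑-map g []       f = refl
  ∑-map g (x ∷ xs) f = +-congˡ (∑-map g xs f)

  ∑-cartesianProductWith : ∀ (h : A → B → C) xs ys f →
    ∑ (cartesianProductWith h xs ys) f ≈ ∑ xs (λ x → ∑ ys (λ y → f (h x y)))
  ∑-cartesianProductWith h []       ys f = refl
  ∑-cartesianProductWith h (x ∷ xs) ys f = begin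
    ∑ (map (h x) ys ++ cartesianProductWith h xs ys) f
      ≈⟨ ∑-++ (map (h x) ys) _ f ⟩
    ∑ (map (h x) ys) f + ∑ (cartesianProductWith h xs ys) f
      ≈⟨ +-cong (∑-map (h x) ys f) (∑-cartesianProductWith h xs ys f) ⟩
    ∑ ys (λ y → f (h x y)) + ∑ xs (λ x → ∑ ys (λ y → f (h x y))) ∎

  -- Flipping a fixed bit permutes the cube. This is what pairs each concept with the one that
  -- differs from it in a single term.
  ∑-flip : ∀ {N} (i : Fin N) f →
    ∑ (vectors (false ∷ true ∷ []) N) f ≈ ∑ (vectors (false ∷ true ∷ []) N) (λ b → f (Vec.updateAt b i not))
  ∑-flip {ℕ.suc N} zero f = begin
    ∑ (vectors bits (ℕ.suc N)) f
      ≈⟨ ∑-cartesianProductWith Vec._∷_ bits (vectors bits N) f ⟩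
    ∑ (vectors bits N) (λ b → f (false Vec.∷ b)) + (∑ (vectors bits N) (λ b → f (true Vec.∷ b)) + 0#)
      ≈⟨ x∙yz≈y∙xz _ _ _ ⟩
    ∑ (vectors bits N) (λ b → f (true Vec.∷ b)) + (∑ (vectors bits N) (λ b → f (false Vec.∷ b)) + 0#)
      ≈⟨ ∑-cartesianProductWith Vec._∷_ bits (vectors bits N) (λ b → f (Vec.updateAt b zero not)) ⟨
    ∑ (vectors bits (ℕ.suc N)) (λ b → f (Vec.updateAt b zero not)) ∎
    where bits = false ∷ true ∷ []
  ∑-flip {ℕ.suc N} (suc i) f = begin
    ∑ (vectors bits (ℕ.suc N)) f
      ≈⟨ ∑-cartesianProductWith Vec._∷_ bits (vectors bits N) f ⟩
    ∑ bits (λ c → ∑ (vectors bits N) (λ b → f (c Vec.∷ b)))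
      ≈⟨ ∑-cong bits (λ c → ∑-flip i (λ b → f (c Vec.∷ b))) ⟩
    ∑ bits (λ c → ∑ (vectors bits N) (λ b → f (c Vec.∷ Vec.updateAt b i not)))
      ≈⟨ ∑-cartesianProductWith Vec._∷_ bits (vectors bits N) (λ b → f (Vec.updateAt b (suc i) not)) ⟨
    ∑ (vectors bits (ℕ.suc N)) (λ b → f (Vec.updateAt b (suc i) not)) ∎
    where bits = false ∷ true ∷ []

-- Counting the points that satisfy terms

module Counting where
  open import Data.Bool.Base using (Bool; true; false; if_then_else_)
  open import Data.Fin.Subset using (∣_∣; _∩_)
  open import Data.List.Base as List using (List; []; _∷_; length; filterᵇ; cartesianProductWith)
  open import Data.List.Properties using (length-++; length-map)
  open import Data.Nat.Base
  open import Data.Nat.Properties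
  open import Data.Nat.Tactic.RingSolver using (solve-∀)
  open import Data.Product.Base using (∃-syntax; _,_)
  open import Data.Vec.Base using (Vec; []; _∷_)
  open import Defs using (-1ₜ; 0ₜ; 1ₜ; Point; points; vectors)
  open import Function.Base using (_∘_)
  open import Relation.Binary.PropositionalEquality
  open import Relation.Nullary using (yes; no; contradiction)
  open ListSum +-0-commutativeMonoid

  ⟦_⟧ : Bool → ℕ
  ⟦ b ⟧ = if b then 1 else 0

  private variable
    X Y Z : Set
    n : ℕ

  ∑-mono : ∀ (xs : List X) {f g} → (∀ x → f x ≤ g x) → ∑ xs f ≤ ∑ xs g
  ∑-mono []       f≤g = z≤n
  ∑-mono (x ∷ xs) f≤g = +-mono-≤ (f≤g x) (∑-mono xs f≤g)

  ∑-*ʳ : ∀ (xs : List X) f c → ∑ xs f * c ≡ ∑ xs (λ x → f x * c)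
  ∑-*ʳ []       f c = refl
  ∑-*ʳ (x ∷ xs) f c = trans (*-distribʳ-+ c (f x) _) (cong (f x * c +_) (∑-*ʳ xs f c))

  ∑-*ˡ : ∀ c (xs : List X) f → ∑ xs (λ x → c * f x) ≡ c * ∑ xs f
  ∑-*ˡ c xs f = trans (∑-cong xs (λ x → *-comm c (f x)))
    (trans (sym (∑-*ʳ xs f c)) (*-comm _ c))

  ∑-replicate : ∀ (xs : List X) c → ∑ xs (λ _ → c) ≡ length xs * c
  ∑-replicate []       c = refl
  ∑-replicate (x ∷ xs) c = cong (c +_) (∑-replicate xs c)

  length-filterᵇ : ∀ (p : X → Bool) xs → length (filterᵇ p xs) ≡ ∑ xs (⟦_⟧ ∘ p)
  length-filterᵇ p [] = refl
  length-filterᵇ p (x ∷ xs) with p x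
  ... | true  = cong suc (length-filterᵇ p xs)
  ... | false = length-filterᵇ p xs

  ∃-≤-average : ∀ (xs : List X) f c → length xs ≢ 0 →
    ∑ xs f ≤ length xs * c → ∃[ x ] f x ≤ c
  ∃-≤-average []       f c ≢0 ∑≤ = contradiction refl ≢0
  ∃-≤-average (x ∷ xs) f c ≢0 ∑≤ with f x ≤? c
  ... | yes fx≤c = x , fx≤c
  ... | no  fx≰c = ∃-≤-average xs f c xs≢0 (+-cancelˡ-≤ c _ _ (≤-trans (+-monoˡ-≤ _ (<⇒≤ c<fx)) ∑≤))
    where
    c<fx = ≰⇒> fx≰c
    xs≢0 : length xs ≢ 0
    xs≢0 eq = <⇒≱ c<fx (≤-trans (m≤m+n (f x) _)
      (≤-trans (subst (λ k → f x + ∑ xs f ≤ c + k * c) eq ∑≤) (≤-reflexive (+-identityʳ c))))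

  length-cartesianProductWith : ∀ (h : X → Y → Z) xs ys →
    length (cartesianProductWith h xs ys) ≡ length xs * length ys
  length-cartesianProductWith h []       ys = refl
  length-cartesianProductWith h (x ∷ xs) ys = trans (length-++ (List.map (h x) ys))
    (cong₂ _+_ (length-map (h x) ys) (length-cartesianProductWith h xs ys))

  length-vectors : ∀ (xs : List X) k → length (vectors xs k) ≡ length xs ^ k
  length-vectors xs zero    = refl
  length-vectors xs (suc k) = trans (length-cartesianProductWith _∷_ xs _)
    (cong (length xs *_) (length-vectors xs k))

  sat : Vec Bool n → Point n → Bool
  sat []          []        = true
  sat (false ∷ A) (_   ∷ y) = sat A y
  sat (true  ∷ A) (1ₜ  ∷ y) = sat A y
  sat (true  ∷ A) (-1ₜ ∷ y) = false
  sat (true  ∷ A) (0ₜ  ∷ y) = false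

  ∑-points-suc : ∀ f → ∑ (points (suc n)) f ≡
    ∑ (points n) (f ∘ (-1ₜ ∷_)) + (∑ (points n) (f ∘ (0ₜ ∷_)) + (∑ (points n) (f ∘ (1ₜ ∷_)) + 0))
  ∑-points-suc {n} f = ∑-cartesianProductWith _∷_ (-1ₜ ∷ 0ₜ ∷ 1ₜ ∷ []) (points n) f

  [s+0]*3t≡3st : ∀ s t → (s + 0) * (3 * t) ≡ 3 * (s * t)
  [s+0]*3t≡3st = solve-∀

  -- Satisfying both terms fixes the coordinates of the union, and the sizes of union and
  -- intersection add up to `∣ A ∣ + ∣ B ∣`.
  ∣sat∩sat∣ : ∀ (A B : Vec Bool n) →
    ∑ (points n) (λ y → ⟦ sat A y ⟧ * ⟦ sat B y ⟧) * 3 ^ (∣ A ∣ + ∣ B ∣) ≡ 3 ^ n * 3 ^ ∣ A ∩ B ∣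
  ∣sat∩sat∣ [] [] = refl
  ∣sat∩sat∣ {suc n} (false ∷ A) (false ∷ B)
    rewrite ∑-points-suc (λ y → ⟦ sat (false ∷ A) y ⟧ * ⟦ sat (false ∷ B) y ⟧) =
    trans (*-assoc 3 (∑ (points n) _) (3 ^ (∣ A ∣ + ∣ B ∣)))
      (trans (cong (3 *_) (∣sat∩sat∣ A B)) (sym (*-assoc 3 (3 ^ n) _)))
  ∣sat∩sat∣ {suc n} (false ∷ A) (true ∷ B)
    rewrite ∑-points-suc (λ y → ⟦ sat (false ∷ A) y ⟧ * ⟦ sat (true ∷ B) y ⟧)
          | ∑-cong (points n) (λ y → *-zeroʳ ⟦ sat A y ⟧) | ∑-zero (points n)
          | +-suc ∣ A ∣ ∣ B ∣ = trans ([s+0]*3t≡3st (∑ (points n) _) (3 ^ (∣ A ∣ + ∣ B ∣)))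
      (trans (cong (3 *_) (∣sat∩sat∣ A B)) (sym (*-assoc 3 (3 ^ n) _)))
  ∣sat∩sat∣ {suc n} (true ∷ A) (false ∷ B)
    rewrite ∑-points-suc (λ y → ⟦ sat (true ∷ A) y ⟧ * ⟦ sat (false ∷ B) y ⟧)
          | ∑-zero (points n) = trans ([s+0]*3t≡3st (∑ (points n) _) (3 ^ (∣ A ∣ + ∣ B ∣)))
      (trans (cong (3 *_) (∣sat∩sat∣ A B)) (sym (*-assoc 3 (3 ^ n) _)))
  ∣sat∩sat∣ {suc n} (true ∷ A) (true ∷ B)
    rewrite ∑-points-suc (λ y → ⟦ sat (true ∷ A) y ⟧ * ⟦ sat (true ∷ B) y ⟧)
          | ∑-zero (points n) | +-suc ∣ A ∣ ∣ B ∣ =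
      trans (lemma (∑ (points n) _) (3 ^ (∣ A ∣ + ∣ B ∣)))
      (trans (cong (9 *_) (∣sat∩sat∣ A B)) (lemma′ (3 ^ n) _))
    where
    lemma : ∀ s t → (s + 0) * (3 * (3 * t)) ≡ 9 * (s * t)
    lemma = solve-∀
    lemma′ : ∀ s t → 9 * (s * t) ≡ (3 * s) * (3 * t)
    lemma′ = solve-∀

  ∣sat∣ : ∀ (A : Vec Bool n) → ∑ (points n) (⟦_⟧ ∘ sat A) * 3 ^ ∣ A ∣ ≡ 3 ^ n
  ∣sat∣ [] = refl
  ∣sat∣ {suc n} (false ∷ A) rewrite ∑-points-suc (⟦_⟧ ∘ sat (false ∷ A)) =
    trans (*-assoc 3 (∑ (points n) _) (3 ^ ∣ A ∣)) (cong (3 *_) (∣sat∣ A))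
  ∣sat∣ {suc n} (true ∷ A) rewrite ∑-points-suc (⟦_⟧ ∘ sat (true ∷ A)) | ∑-zero (points n) =
    trans ([s+0]*3t≡3st (∑ (points n) _) _) (cong (3 *_) (∣sat∣ A))

-- A large family of terms with small overlaps

module Family where
  open import Data.Bool.Base using (Bool; true; false; not; _∧_; if_then_else_)
  open import Data.Fin.Base using (Fin; zero; suc)
  open import Data.Fin.Subset using (∣_∣; _∩_; ⁅_⁆; ⊥)
  open import Data.Fin.Subset.Properties using (∣⊥∣≡0; ∣⁅x⁆∣≡1; ∩-zeroˡ; ∩-zeroʳ)
  open import Data.List.Base as List using (List; []; _∷_; length; allFin)
  open import Data.List.Properties using (length-tabulate; map-tabulate)
  open import Data.Nat.Base
  open import Data.Nat.Properties
  open import Data.Nat.Tactic.RingSolver using (solve-∀)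
  open import Data.Product.Base using (∃-syntax; _×_; _,_)
  open import Data.Vec.Base as Vec using (Vec; []; _∷_; _++_; lookup)
  open import Data.Vec.Properties using (zipWith-++; toList-map; length-toList; lookup-map)
  open import Defs using (Point; points; vectors)
  open import Function.Base using (_∘_; id; _⟨_⟩_)
  open import Relation.Binary.PropositionalEquality
  open ListSum +-0-commutativeMonoid
  open Counting
  private variable
    n N q w s : ℕ

  ∣++∣ : ∀ {k l} (A : Vec Bool k) (B : Vec Bool l) → ∣ A ++ B ∣ ≡ ∣ A ∣ + ∣ B ∣
  ∣++∣ []          B = refl
  ∣++∣ (true  ∷ A) B = cong suc (∣++∣ A B)
  ∣++∣ (false ∷ A) B = ∣++∣ A B

  -- There are w blocks of length q, then s coordinates that no term uses and that absorb the
  -- difference to the ambient dimension. The recursion follows that of `term`, which thus needs no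
  -- transport along an arithmetic identity.
  dim : ℕ → ℕ → ℕ → ℕ
  dim q zero    s = s
  dim q (suc w) s = q + dim q w s

  dim≡ : ∀ q w s → dim q w s ≡ w * q + s
  dim≡ q zero    s = refl
  dim≡ q (suc w) s = trans (cong (q +_) (dim≡ q w s)) (sym (+-assoc q (w * q) s))

  term : Vec (Fin q) w → Vec Bool (dim q w s)
  term []      = ⊥
  term (j ∷ v) = ⁅ j ⁆ ++ term v

  ∣term∣ : ∀ (v : Vec (Fin q) w) → ∣ term {s = s} v ∣ ≡ w
  ∣term∣ {s = s} [] = ∣⊥∣≡0 s
  ∣term∣ (j ∷ v) = trans (∣++∣ ⁅ j ⁆ (term v)) (cong₂ _+_ (∣⁅x⁆∣≡1 j) (∣term∣ v))

  ∑-allFin-suc : ∀ q f → ∑ (allFin (suc q)) f ≡ f zero + ∑ (allFin q) (f ∘ suc)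
  ∑-allFin-suc q f = cong (λ js → f zero + ∑ js f) (sym (map-tabulate id suc))
    ⟨ trans ⟩ cong (f zero +_) (∑-map suc (allFin q) f)

  -- The index j = i contributes 3, the other q - 1 contribute 1 each.
  ∑3^∣⁅i⁆∩⁅j⁆∣ : ∀ (i : Fin q) → ∑ (allFin q) (λ j → 3 ^ ∣ ⁅ i ⁆ ∩ ⁅ j ⁆ ∣) ≡ q + 2
  ∑3^∣⁅i⁆∩⁅j⁆∣ {suc q} zero = begin
    ∑ (allFin (suc q)) (λ j → 3 ^ ∣ ⁅ zero ⁆ ∩ ⁅ j ⁆ ∣)
      ≡⟨ ∑-allFin-suc q (λ j → 3 ^ ∣ ⁅ zero ⁆ ∩ ⁅ j ⁆ ∣) ⟩
    3 ^ suc ∣ ⊥ {n = q} ∩ ⊥ ∣ + ∑ (allFin q) (λ j → 3 ^ ∣ ⊥ ∩ ⁅ j ⁆ ∣)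
      ≡⟨ cong₂ _+_ (cong (λ k → 3 ^ suc k) (∅∩≡0 {n = q} ⊥)) (∑-cong (allFin q) (λ j → cong (3 ^_) (∅∩≡0 ⁅ j ⁆))) ⟩
    3 + ∑ (allFin q) (λ _ → 1)
      ≡⟨ cong (3 +_) (∑-replicate (allFin q) 1) ⟩
    3 + length (allFin q) * 1
      ≡⟨ cong (λ k → 3 + k * 1) (length-tabulate {n = q} id) ⟩
    3 + q * 1
      ≡⟨ lemma q ⟩
    suc q + 2 ∎
    where
    open ≡-Reasoning
    ∅∩≡0 : ∀ {n} (B : Vec Bool n) → ∣ ⊥ ∩ B ∣ ≡ 0
    ∅∩≡0 {n} B = trans (cong ∣_∣ (∩-zeroˡ B)) (∣⊥∣≡0 n)
    lemma : ∀ q → 3 + q * 1 ≡ suc q + 2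
    lemma = solve-∀
  ∑3^∣⁅i⁆∩⁅j⁆∣ {suc q} (suc i) = begin
    ∑ (allFin (suc q)) (λ j → 3 ^ ∣ ⁅ suc i ⁆ ∩ ⁅ j ⁆ ∣)
      ≡⟨ ∑-allFin-suc q (λ j → 3 ^ ∣ ⁅ suc i ⁆ ∩ ⁅ j ⁆ ∣) ⟩
    3 ^ ∣ ⁅ i ⁆ ∩ ⊥ ∣ + ∑ (allFin q) (λ j → 3 ^ ∣ ⁅ i ⁆ ∩ ⁅ j ⁆ ∣)
      ≡⟨ cong₂ _+_ (cong (3 ^_) (trans (cong ∣_∣ (∩-zeroʳ ⁅ i ⁆)) (∣⊥∣≡0 q))) (∑3^∣⁅i⁆∩⁅j⁆∣ i) ⟩
    suc q + 2 ∎
    where open ≡-Reasoning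

  -- The overlap adds over the blocks, so the sum over all codes factors into one sum per block.
  ∑3^∣term∩term∣ : ∀ (u : Vec (Fin q) w) →
    ∑ (vectors (allFin q) w) (λ v → 3 ^ ∣ term {s = s} u ∩ term v ∣) ≡ (q + 2) ^ w
  ∑3^∣term∩term∣ {s = s} [] = cong (λ k → 3 ^ k + 0) (trans (cong ∣_∣ (∩-zeroˡ {n = s} ⊥)) (∣⊥∣≡0 s))
  ∑3^∣term∩term∣ {q} {suc w} {s} (i ∷ u) = begin
    ∑ (vectors (allFin q) (suc w)) (λ v → 3 ^ ∣ term {s = s} (i ∷ u) ∩ term v ∣)
      ≡⟨ ∑-cartesianProductWith _∷_ (allFin q) (vectors (allFin q) w) _ ⟩
    ∑ (allFin q) (λ j → ∑ (vectors (allFin q) w) (λ v → 3 ^ ∣ term {s = s} (i ∷ u) ∩ term (j ∷ v) ∣))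
      ≡⟨ ∑-cong (allFin q) (λ j → trans (∑-cong (vectors (allFin q) w) (split j))
           (∑-*ˡ (3 ^ ∣ ⁅ i ⁆ ∩ ⁅ j ⁆ ∣) (vectors (allFin q) w) (λ v → 3 ^ ∣ term {s = s} u ∩ term v ∣))) ⟩
    ∑ (allFin q) (λ j → 3 ^ ∣ ⁅ i ⁆ ∩ ⁅ j ⁆ ∣ * ∑ (vectors (allFin q) w) (λ v → 3 ^ ∣ term {s = s} u ∩ term v ∣))
      ≡⟨ ∑-*ʳ (allFin q) (λ j → 3 ^ ∣ ⁅ i ⁆ ∩ ⁅ j ⁆ ∣) _ ⟨
    ∑ (allFin q) (λ j → 3 ^ ∣ ⁅ i ⁆ ∩ ⁅ j ⁆ ∣) * ∑ (vectors (allFin q) w) (λ v → 3 ^ ∣ term {s = s} u ∩ term v ∣)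
      ≡⟨ cong₂ _*_ (∑3^∣⁅i⁆∩⁅j⁆∣ i) (∑3^∣term∩term∣ u) ⟩
    (q + 2) ^ suc w ∎
    where
    open ≡-Reasoning
    split : ∀ j v → 3 ^ ∣ (⁅ i ⁆ ++ term u) ∩ (⁅ j ⁆ ++ term v) ∣ ≡
      3 ^ ∣ ⁅ i ⁆ ∩ ⁅ j ⁆ ∣ * 3 ^ ∣ term {s = s} u ∩ term v ∣
    split j v = begin
      3 ^ ∣ (⁅ i ⁆ ++ term u) ∩ (⁅ j ⁆ ++ term v) ∣
        ≡⟨ cong (λ A → 3 ^ ∣ A ∣) (zipWith-++ _∧_ ⁅ i ⁆ (term u) ⁅ j ⁆ (term v)) ⟩
      3 ^ ∣ (⁅ i ⁆ ∩ ⁅ j ⁆) ++ (term u ∩ term v) ∣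
        ≡⟨ cong (3 ^_) (∣++∣ (⁅ i ⁆ ∩ ⁅ j ⁆) (term u ∩ term v)) ⟩
      3 ^ (∣ ⁅ i ⁆ ∩ ⁅ j ⁆ ∣ + ∣ term u ∩ term v ∣)
        ≡⟨ ^-distribˡ-+-* 3 ∣ ⁅ i ⁆ ∩ ⁅ j ⁆ ∣ _ ⟩
      3 ^ ∣ ⁅ i ⁆ ∩ ⁅ j ⁆ ∣ * 3 ^ ∣ term u ∩ term v ∣ ∎

  -- (1 - 2/(q+2))^w ≥ 1 - 2w/(q+2) at t = q + 2 - 2w, without division and subtraction.
  bernoulli : ∀ q w t → t + 2 * w ≤ q + 2 → (q + 2) ^ w * t ≤ q ^ w * (t + 2 * w)
  bernoulli q zero    t _ = ≤-reflexive (lemma t)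
    where
    lemma : ∀ t → 1 * t ≡ 1 * (t + 2 * 0)
    lemma = solve-∀
  bernoulli q (suc w) t h = begin
    (q + 2) * (q + 2) ^ w * t           ≡⟨ lemma₁ q t ((q + 2) ^ w) ⟩
    (q + 2) ^ w * (q * t + 2 * t)       ≤⟨ *-monoʳ-≤ ((q + 2) ^ w) (+-monoʳ-≤ (q * t) (*-monoʳ-≤ 2 t≤q)) ⟩
    (q + 2) ^ w * (q * t + 2 * q)       ≡⟨ lemma₂ q t ((q + 2) ^ w) ⟩
    q * ((q + 2) ^ w * (t + 2))
      ≤⟨ *-monoʳ-≤ q (bernoulli q w (t + 2) (≤-trans (≤-reflexive (lemma₃ t w)) h)) ⟩
    q * (q ^ w * (t + 2 + 2 * w))       ≡⟨ lemma₄ q t w (q ^ w) ⟩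
    q * q ^ w * (t + 2 * suc w)         ∎
    where
    open ≤-Reasoning
    lemma₃ : ∀ t w → t + 2 + 2 * w ≡ t + 2 * suc w
    lemma₃ = solve-∀
    lemma₅ : ∀ t w → t + 2 * suc w ≡ t + 2 * w + 2
    lemma₅ = solve-∀
    t≤q : t ≤ q
    t≤q = ≤-trans (m≤m+n t (2 * w)) (+-cancelʳ-≤ 2 _ _ (≤-trans (≤-reflexive (sym (lemma₅ t w))) h))
    lemma₁ : ∀ q t x → (q + 2) * x * t ≡ x * (q * t + 2 * t)
    lemma₁ = solve-∀
    lemma₂ : ∀ q t x → x * (q * t + 2 * q) ≡ q * (x * (t + 2))
    lemma₂ = solve-∀
    lemma₄ : ∀ q t w x → q * (x * (t + 2 + 2 * w)) ≡ q * x * (t + 2 * suc w)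
    lemma₄ = solve-∀

  -- This is where the block length 4w comes from: it keeps the mean (1 + 2/(4w))^w of 3^overlap at
  -- most 2 for every w. In `bernoulli`, t = 2w makes t + 2w exactly twice t.
  [4w+2]^w≤2[4w]^w : ∀ w → (4 * w + 2) ^ w ≤ 2 * (4 * w) ^ w
  [4w+2]^w≤2[4w]^w zero = s≤s z≤n
  [4w+2]^w≤2[4w]^w w@(suc _) = *-cancelʳ-≤ _ _ (2 * w) (≤-trans
    (bernoulli (4 * w) w (2 * w) (≤-trans (≤-reflexive (lemma₁ w)) (m≤m+n (4 * w) 2)))
    (≤-reflexive (lemma₂ w ((4 * w) ^ w))))
    where
    lemma₁ : ∀ w → 2 * w + 2 * w ≡ 4 * w
    lemma₁ = solve-∀
    lemma₂ : ∀ w x → x * (2 * w + 2 * w) ≡ 2 * x * (2 * w)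
    lemma₂ = solve-∀

  -- For terms of size w, this sum over unordered pairs is the total number of points satisfying
  -- both terms of a pair, up to the factor 3^(n - 2w).
  overlaps : Vec (Vec Bool n) N → ℕ
  overlaps []       = 0
  overlaps (A ∷ As) = ∑ (Vec.toList As) (λ B → 3 ^ ∣ B ∩ A ∣) + overlaps As

  module _ (w s : ℕ) where
    private
      codes : List (Vec (Fin (4 * w)) w)
      codes = vectors (allFin (4 * w)) w
      tm : Vec (Fin (4 * w)) w → Vec Bool (dim (4 * w) w s)
      tm = term
      length-codes : length codes ≡ (4 * w) ^ w
      length-codes = trans (length-vectors (allFin (4 * w)) w) (cong (_^ w) (length-tabulate {n = 4 * w} id))
      codes≢0 : length codes ≢ 0
      codes≢0 eq = 4w^w≢0 w (trans (sym length-codes) eq)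
        where
        4w^w≢0 : ∀ w → (4 * w) ^ w ≢ 0
        4w^w≢0 zero      ()
        4w^w≢0 w@(suc _) = ≢-nonZero⁻¹ _ {{m^n≢0 (4 * w) w}}

    -- First-moment method: a uniformly random code has mean 3^overlap at most 2 with each earlier
    -- code, so some code does at least as well against all of them in total.
    next : ∀ (vs : List (Vec (Fin (4 * w)) w)) →
      ∃[ v ] ∑ vs (λ u → 3 ^ ∣ tm u ∩ tm v ∣) ≤ 2 * length vs
    next vs = ∃-≤-average codes (λ v → ∑ vs (λ u → 3 ^ ∣ tm u ∩ tm v ∣)) (2 * length vs) codes≢0 (begin
      ∑ codes (λ v → ∑ vs (λ u → 3 ^ ∣ tm u ∩ tm v ∣))
        ≡⟨ ∑-comm codes vs (λ v u → 3 ^ ∣ tm u ∩ tm v ∣) ⟩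
      ∑ vs (λ u → ∑ codes (λ v → 3 ^ ∣ tm u ∩ tm v ∣))
        ≡⟨ ∑-cong vs ∑3^∣term∩term∣ ⟩
      ∑ vs (λ _ → (4 * w + 2) ^ w)
        ≡⟨ ∑-replicate vs _ ⟩
      length vs * (4 * w + 2) ^ w
        ≤⟨ *-monoʳ-≤ (length vs) ([4w+2]^w≤2[4w]^w w) ⟩
      length vs * (2 * (4 * w) ^ w)
        ≡⟨ lemma (length vs) ((4 * w) ^ w) ⟩
      (4 * w) ^ w * (2 * length vs)
        ≡⟨ cong (_* (2 * length vs)) length-codes ⟨
      length codes * (2 * length vs) ∎)
      where
      open ≤-Reasoning
      lemma : ∀ l x → l * (2 * x) ≡ x * (2 * l)
      lemma = solve-∀


    -- A term chosen after k others adds at most 2k, which sums to N(N - 1); `2 * N ^ 2` is a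
    -- convenient weaker bound.
    greedy : ∀ N → ∃[ As ] (∀ i → ∣ lookup As i ∣ ≡ w) × overlaps {dim (4 * w) w s} {N} As ≤ 2 * N ^ 2
    greedy N = let vs , h = codewords N in
      Vec.map tm vs ,
      (λ i → trans (cong ∣_∣ (lookup-map i tm vs)) (∣term∣ (lookup vs i))) , h
      where
      codewords : ∀ N → ∃[ vs ] overlaps {N = N} (Vec.map tm vs) ≤ 2 * N ^ 2
      codewords zero    = [] , z≤n
      codewords (suc N) = let vs , h = codewords N ; v , h′ = next (Vec.toList vs) in
        v ∷ vs , (begin
          ∑ (Vec.toList (Vec.map tm vs)) (λ B → 3 ^ ∣ B ∩ tm v ∣) + overlaps (Vec.map tm vs)
            ≡⟨ cong (λ Bs → ∑ Bs (λ B → 3 ^ ∣ B ∩ tm v ∣) + overlaps (Vec.map tm vs)) (toList-map tm vs) ⟩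
          ∑ (List.map tm (Vec.toList vs)) (λ B → 3 ^ ∣ B ∩ tm v ∣) + overlaps (Vec.map tm vs)
            ≡⟨ cong (_+ overlaps (Vec.map tm vs)) (∑-map tm (Vec.toList vs) (λ B → 3 ^ ∣ B ∩ tm v ∣)) ⟩
          ∑ (Vec.toList vs) (λ u → 3 ^ ∣ tm u ∩ tm v ∣) + overlaps (Vec.map tm vs)
            ≤⟨ +-mono-≤ h′ h ⟩
          2 * length (Vec.toList vs) + 2 * N ^ 2
            ≡⟨ cong (λ k → 2 * k + 2 * N ^ 2) (length-toList vs) ⟩
          2 * N + 2 * N ^ 2
            ≤⟨ m≤m+n _ (2 * N + 2) ⟩
          2 * N + 2 * N ^ 2 + (2 * N + 2)
            ≡⟨ lemma N ⟩
          2 * suc N ^ 2 ∎)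
        where
        open ≤-Reasoning
        lemma : ∀ N → 2 * N + 2 * (N * (N * 1)) + (2 * N + 2) ≡ 2 * (suc N * (suc N * 1))
        lemma = solve-∀

  none unique : Vec (Vec Bool n) N → Point n → Bool
  none []         y = true
  none (A ∷ As)   y = not (sat A y) ∧ none As y
  unique []       y = false
  unique (A ∷ As) y = if sat A y then none As y else unique As y

  hits pairs : Vec (Vec Bool n) N → Point n → ℕ
  hits []        y = 0
  hits (A ∷ As)  y = ⟦ sat A y ⟧ + hits As y
  pairs []       y = 0
  pairs (A ∷ As) y = ∑ (Vec.toList As) (λ B → ⟦ sat B y ⟧ * ⟦ sat A y ⟧) + pairs As y

  ∑≡hits : ∀ (As : Vec (Vec Bool n) N) y → ∑ (Vec.toList As) (λ B → ⟦ sat B y ⟧) ≡ hits As y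
  ∑≡hits []       y = refl
  ∑≡hits (B ∷ Bs) y = cong (⟦ sat B y ⟧ +_) (∑≡hits Bs y)

  -- If y satisfies h terms, then `pairs` is h(h - 1)/2 and the claim is h ≤ [h = 1] + h(h - 1). It
  -- bounds the uniquely covered points from below by first and second moments only.
  hits≤unique+2pairs : ∀ (As : Vec (Vec Bool n) N) y → hits As y ≤ ⟦ unique As y ⟧ + 2 * pairs As y
  hits≤unique+2pairs [] y = z≤n
  hits≤unique+2pairs (A ∷ As) y rewrite sym (∑-*ʳ (Vec.toList As) (λ B → ⟦ sat B y ⟧) ⟦ sat A y ⟧) | ∑≡hits As y
    with sat A y
  ... | false = ≤-trans (hits≤unique+2pairs As y)
    (≤-reflexive (cong (λ k → ⟦ unique As y ⟧ + 2 * (k + pairs As y)) (sym (*-zeroʳ (hits As y)))))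
  -- Each later term satisfied by y forms a pair with A. These pairs alone suffice, since 1 + h ≤
  -- [h = 0] + 2h for h later terms.
  ... | true = ≤-trans (positive As) (+-monoʳ-≤ ⟦ none As y ⟧ (*-monoʳ-≤ 2
      (≤-trans (≤-reflexive (sym (*-identityʳ (hits As y)))) (m≤m+n _ (pairs As y)))))
    where
    positive : ∀ {N} (As : Vec (Vec Bool _) N) → 1 + hits As y ≤ ⟦ none As y ⟧ + 2 * hits As y
    positive [] = ≤-refl
    positive (B ∷ Bs) with sat B y
    ... | false = positive Bs
    ... | true  = ≤-trans (m≤m+n _ (hits Bs y)) (≤-reflexive (lemma (hits Bs y)))
      where
      lemma : ∀ h → 1 + (1 + h) + h ≡ 2 * (1 + h)
      lemma = solve-∀

  ∑hits : ∀ (As : Vec (Vec Bool n) N) → (∀ i → ∣ lookup As i ∣ ≡ w) →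
    ∑ (points n) (hits As) * 3 ^ w ≡ N * 3 ^ n
  ∑hits {n} [] _ = cong (_* _) (∑-zero (points n))
  ∑hits {n} {suc N} {w} (A ∷ As) h = begin
    ∑ (points n) (λ y → ⟦ sat A y ⟧ + hits As y) * 3 ^ w
      ≡⟨ cong (_* 3 ^ w) (∑-distrib-+ (points n) (λ y → ⟦ sat A y ⟧) (hits As)) ⟩
    (∑ (points n) (λ y → ⟦ sat A y ⟧) + ∑ (points n) (hits As)) * 3 ^ w
      ≡⟨ *-distribʳ-+ (3 ^ w) (∑ (points n) (λ y → ⟦ sat A y ⟧)) _ ⟩
    ∑ (points n) (λ y → ⟦ sat A y ⟧) * 3 ^ w + ∑ (points n) (hits As) * 3 ^ w
      ≡⟨ cong₂ _+_ (subst (λ k → ∑ (points n) (⟦_⟧ ∘ sat A) * 3 ^ k ≡ 3 ^ n) (h zero) (∣sat∣ A))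
           (∑hits As (h ∘ suc)) ⟩
    3 ^ n + N * 3 ^ n ∎
    where open ≡-Reasoning

  ∑pairs : ∀ (As : Vec (Vec Bool n) N) → (∀ i → ∣ lookup As i ∣ ≡ w) →
    ∑ (points n) (pairs As) * 3 ^ (w + w) ≡ 3 ^ n * overlaps As
  ∑pairs {n} [] _ = trans (cong (_* _) (∑-zero (points n))) (sym (*-zeroʳ (3 ^ n)))
  ∑pairs {n} {suc N} {w} (A ∷ As) h = begin
    ∑ (points n) (λ y → ∑ (Vec.toList As) (λ B → ⟦ sat B y ⟧ * ⟦ sat A y ⟧) + pairs As y) * 3 ^ (w + w)
      ≡⟨ cong (_* 3 ^ (w + w)) (∑-distrib-+ (points n) _ (pairs As)) ⟩
    (∑ (points n) (λ y → ∑ (Vec.toList As) (λ B → ⟦ sat B y ⟧ * ⟦ sat A y ⟧)) + ∑ (points n) (pairs As)) * 3 ^ (w + w)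
      ≡⟨ *-distribʳ-+ (3 ^ (w + w)) (∑ (points n) _) _ ⟩
    ∑ (points n) (λ y → ∑ (Vec.toList As) (λ B → ⟦ sat B y ⟧ * ⟦ sat A y ⟧)) * 3 ^ (w + w)
      + ∑ (points n) (pairs As) * 3 ^ (w + w)
      ≡⟨ cong₂ _+_ (trans (cong (_* 3 ^ (w + w))
             (∑-comm (points n) (Vec.toList As) (λ y B → ⟦ sat B y ⟧ * ⟦ sat A y ⟧)))
           (first As (h ∘ suc))) (∑pairs As (h ∘ suc)) ⟩
    3 ^ n * ∑ (Vec.toList As) (λ B → 3 ^ ∣ B ∩ A ∣) + 3 ^ n * overlaps As
      ≡⟨ *-distribˡ-+ (3 ^ n) (∑ (Vec.toList As) (λ B → 3 ^ ∣ B ∩ A ∣)) (overlaps As) ⟨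
    3 ^ n * overlaps (A ∷ As) ∎
    where
    open ≡-Reasoning
    first : ∀ {N} (As : Vec (Vec Bool n) N) → (∀ i → ∣ lookup As i ∣ ≡ w) →
      ∑ (Vec.toList As) (λ B → ∑ (points n) (λ y → ⟦ sat B y ⟧ * ⟦ sat A y ⟧)) * 3 ^ (w + w) ≡
      3 ^ n * ∑ (Vec.toList As) (λ B → 3 ^ ∣ B ∩ A ∣)
    first []       _ = sym (*-zeroʳ (3 ^ n))
    first (B ∷ Bs) hB = begin
      (∑ (points n) (λ y → ⟦ sat B y ⟧ * ⟦ sat A y ⟧) + rest) * 3 ^ (w + w)
        ≡⟨ *-distribʳ-+ (3 ^ (w + w)) (∑ (points n) (λ y → ⟦ sat B y ⟧ * ⟦ sat A y ⟧)) rest ⟩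
      ∑ (points n) (λ y → ⟦ sat B y ⟧ * ⟦ sat A y ⟧) * 3 ^ (w + w) + rest * 3 ^ (w + w)
        ≡⟨ cong₂ _+_ (subst₂
             (λ j k → ∑ (points n) (λ y → ⟦ sat B y ⟧ * ⟦ sat A y ⟧) * 3 ^ (j + k) ≡ 3 ^ n * 3 ^ ∣ B ∩ A ∣)
             (hB zero) (h zero) (∣sat∩sat∣ B A)) (first Bs (hB ∘ suc)) ⟩
      3 ^ n * 3 ^ ∣ B ∩ A ∣ + 3 ^ n * ∑ (Vec.toList Bs) (λ B → 3 ^ ∣ B ∩ A ∣)
        ≡⟨ *-distribˡ-+ (3 ^ n) (3 ^ ∣ B ∩ A ∣) _ ⟨
      3 ^ n * (3 ^ ∣ B ∩ A ∣ + ∑ (Vec.toList Bs) (λ B → 3 ^ ∣ B ∩ A ∣)) ∎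
      where
      rest = ∑ (Vec.toList Bs) (λ B → ∑ (points n) (λ y → ⟦ sat B y ⟧ * ⟦ sat A y ⟧))

  -- With K = 3^v terms of size 2 + v, the mean of `hits` is 1/9 and that of `pairs` at most 2/81,
  -- which leaves 1/9 - 2·2/81 = 5/81. Fewer terms would cover too little, and many more would let
  -- the pairs dominate. The computation is scaled by 81K² = 3^(2(2 + v)), and the pair term is
  -- added to both sides instead of subtracted.
  ∣unique∣-large : ∀ v (As : Vec (Vec Bool n) (3 ^ v)) → (∀ i → ∣ lookup As i ∣ ≡ 2 + v) →
    overlaps As ≤ 2 * (3 ^ v) ^ 2 → 5 * 3 ^ n ≤ 81 * ∑ (points n) (⟦_⟧ ∘ unique As)
  ∣unique∣-large {n} v As h ov = *-cancelʳ-≤ _ _ ((3 ^ v) ^ 2) {{m^n≢0 (3 ^ v) 2 {{m^n≢0 3 v}}}}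
    (+-cancelʳ-≤ (4 * M * K ^ 2) _ _ (begin
      5 * M * K ^ 2 + 4 * M * K ^ 2
        ≡⟨ lemma₁ M K ⟩
      (K * M) * (9 * K)
        ≡⟨ cong (_* (9 * K)) (∑hits As h) ⟨
      ∑ (points n) (hits As) * 3 ^ (2 + v) * (9 * K)
        ≡⟨ lemma₂ (∑ (points n) (hits As)) K ⟩
      ∑ (points n) (hits As) * (81 * K ^ 2)
        ≤⟨ *-monoˡ-≤ (81 * K ^ 2) (∑-mono (points n) (hits≤unique+2pairs As)) ⟩
      ∑ (points n) (λ y → ⟦ unique As y ⟧ + 2 * pairs As y) * (81 * K ^ 2)
        ≡⟨ cong (_* (81 * K ^ 2)) (trans (∑-distrib-+ (points n) (⟦_⟧ ∘ unique As) _)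
             (cong (r +_) (∑-*ˡ 2 (points n) (pairs As)))) ⟩
      (r + 2 * p) * (81 * K ^ 2)
        ≡⟨ lemma₃ r p K ⟩
      81 * r * K ^ 2 + 2 * (p * ((9 * K) * (9 * K)))
        ≡⟨ cong (λ k → 81 * r * K ^ 2 + 2 * k) (trans (cong (p *_) 9K*9K≡) (∑pairs As h)) ⟩
      81 * r * K ^ 2 + 2 * (M * overlaps As)
        ≤⟨ +-monoʳ-≤ (81 * r * K ^ 2) (*-monoʳ-≤ 2 (*-monoʳ-≤ M ov)) ⟩
      81 * r * K ^ 2 + 2 * (M * (2 * K ^ 2))
        ≡⟨ cong (81 * r * K ^ 2 +_) (lemma₄ M K) ⟩
      81 * r * K ^ 2 + 4 * M * K ^ 2 ∎))
    where
    open ≤-Reasoning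
    M = 3 ^ n
    K = 3 ^ v
    r = ∑ (points n) (⟦_⟧ ∘ unique As)
    p = ∑ (points n) (pairs As)
    9K≡ : 9 * K ≡ 3 ^ (2 + v)
    9K≡ = *-assoc 3 3 K
    9K*9K≡ : (9 * K) * (9 * K) ≡ 3 ^ ((2 + v) + (2 + v))
    9K*9K≡ = trans (cong₂ _*_ 9K≡ 9K≡) (sym (^-distribˡ-+-* 3 (2 + v) (2 + v)))
    lemma₁ : ∀ M K → 5 * M * (K * (K * 1)) + 4 * M * (K * (K * 1)) ≡ K * M * (9 * K)
    lemma₁ = solve-∀
    lemma₂ : ∀ x K → x * (3 * (3 * K)) * (9 * K) ≡ x * (81 * (K * (K * 1)))
    lemma₂ = solve-∀
    lemma₃ : ∀ r p K → (r + 2 * p) * (81 * (K * (K * 1))) ≡ 81 * r * (K * (K * 1)) + 2 * (p * ((9 * K) * (9 * K)))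
    lemma₃ = solve-∀
    lemma₄ : ∀ M K → 2 * (M * (2 * (K * (K * 1)))) ≡ 4 * M * (K * (K * 1))
    lemma₄ = solve-∀

-- Concepts indexed by bit vectors, and terms unseen by a sample

module Concepts where
  open import Data.Bool.Base using (Bool; true; false; not; _∧_; _∨_)
  open import Data.Fin.Base using (Fin; zero; suc)
  open import Data.Fin.Subset using (∣_∣)
  open import Data.List.Base using (length)
  open import Data.Nat.Base
  open import Data.Nat.Properties
  open import Data.Nat.Tactic.RingSolver using (solve-∀)
  open import Data.Product.Base using (∃-syntax; _,_)
  open import Data.Vec.Base using (Vec; []; _∷_; lookup; updateAt)
  open import Defs using (Point; Subset; points; vectors; label)
  open import Function.Base using (_∘_)
  open import Relation.Binary.PropositionalEquality
  open ListSum +-0-commutativeMonoid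
  open Counting
  open Family using (none; unique)
  private variable
    n N m : ℕ

  hit : Vec (Vec Bool n) N → Vec Bool N → Subset n
  hit []       []       x = false
  hit (A ∷ As) (b ∷ bs) x = (b ∧ sat A x) ∨ hit As bs x

  concept : Vec (Vec Bool n) N → Vec Bool N → Subset n
  concept As b x = not (hit As b x)

  none⇒¬hit : ∀ (As : Vec (Vec Bool n) N) b y → none As y ≡ true → hit As b y ≡ false
  none⇒¬hit []       []       y _ = refl
  none⇒¬hit (A ∷ As) (b ∷ bs) y eq with sat A y
  none⇒¬hit (A ∷ As) (false ∷ bs) y eq | false = none⇒¬hit As bs y eq
  none⇒¬hit (A ∷ As) (true  ∷ bs) y eq | false = none⇒¬hit As bs y eq

  -- If i is the only term that y satisfies, the label of y is the negation of bit i, whatever the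
  -- other bits are.
  unique⇒flips : ∀ (As : Vec (Vec Bool n) N) y → unique As y ≡ true →
    ∃[ i ] (∀ b → concept As (updateAt b i not) y ≡ not (concept As b y))
  unique⇒flips (A ∷ As) y eq with sat A y in satA
  ... | true  = zero , λ where
    (false ∷ b) → cong not (trans (cong (_∨ hit As b y) satA) (cong not (sym (none⇒¬hit As b y eq))))
    (true  ∷ b) → cong not (trans (none⇒¬hit As b y eq) (cong (λ c → not (c ∨ hit As b y)) (sym satA)))
  ... | false with unique⇒flips As y eq
  ...   | i , flips = suc i , λ where
    (false ∷ b) → flips b
    (true  ∷ b) → trans (cong (λ c → not (c ∨ hit As (updateAt b i not) y)) satA)
      (trans (flips b) (cong (λ c → not (not (c ∨ hit As b y))) (sym satA)))

  concept-flip : ∀ (As : Vec (Vec Bool n) N) b i x → sat (lookup As i) x ≡ false →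
    concept As (updateAt b i not) x ≡ concept As b x
  concept-flip (A ∷ As) (false ∷ b) zero    x eq rewrite eq = refl
  concept-flip (A ∷ As) (true  ∷ b) zero    x eq rewrite eq = refl
  concept-flip (A ∷ As) (false ∷ b) (suc i) x eq = concept-flip As b i x eq
  concept-flip (A ∷ As) (true  ∷ b) (suc i) x eq with sat A x
  ... | true  = refl
  ... | false = concept-flip As b i x eq

  seen : Vec Bool n → Vec (Point n) m → Bool
  seen A []       = false
  seen A (x ∷ xs) = sat A x ∨ seen A xs

  -- Indistinguishability: on such a sample the learner receives the same input, hence returns the
  -- same distribution, for both concepts.
  label-flip : ∀ (As : Vec (Vec Bool n) N) b i (xs : Vec (Point n) m) → seen (lookup As i) xs ≡ false →
    label (concept As (updateAt b i not)) xs ≡ label (concept As b) xs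
  label-flip As b i []       _ = refl
  label-flip As b i (x ∷ xs) eq with sat (lookup As i) x in satx
  ... | false = cong₂ _∷_ (cong (x ,_) (concept-flip As b i x satx)) (label-flip As b i xs eq)

  length-points : ∀ n → length (points n) ≡ 3 ^ n
  length-points n = length-vectors _ n

  length-samples : ∀ n m → length (vectors (points n) m) ≡ (3 ^ n) ^ m
  length-samples n m = trans (length-vectors (points n) m) (cong (_^ m) (length-points n))

  -- Union bound over the m examples, each of which satisfies A with probability 3^(-∣A∣).
  ∣seen∣ : ∀ m (A : Vec Bool n) →
    ∑ (vectors (points n) m) (⟦_⟧ ∘ seen A) * 3 ^ ∣ A ∣ ≤ m * (3 ^ n) ^ m
  ∣seen∣ zero A = z≤n
  ∣seen∣ {n} (suc m) A = begin
    ∑ (vectors (points n) (suc m)) (⟦_⟧ ∘ seen A) * p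
      ≡⟨ cong (_* p) (∑-cartesianProductWith _∷_ (points n) (vectors (points n) m) (⟦_⟧ ∘ seen A)) ⟩
    ∑ (points n) (λ x → ∑ (vectors (points n) m) (λ xs → ⟦ sat A x ∨ seen A xs ⟧)) * p
      ≤⟨ *-monoˡ-≤ p (∑-mono (points n) (λ x → ∑-mono (vectors (points n) m) (λ xs → ⟦∨⟧≤ (sat A x) (seen A xs)))) ⟩
    ∑ (points n) (λ x → ∑ (vectors (points n) m) (λ xs → ⟦ sat A x ⟧ + ⟦ seen A xs ⟧)) * p
      ≡⟨ cong (_* p) (∑-cong (points n) (λ x → trans
           (∑-distrib-+ (vectors (points n) m) (λ _ → ⟦ sat A x ⟧) (⟦_⟧ ∘ seen A))
           (cong (_+ c) (trans (∑-replicate (vectors (points n) m) ⟦ sat A x ⟧)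
             (trans (cong (_* ⟦ sat A x ⟧) (length-samples n m)) (*-comm D ⟦ sat A x ⟧)))))) ⟩
    ∑ (points n) (λ x → ⟦ sat A x ⟧ * D + c) * p
      ≡⟨ cong (_* p) (∑-distrib-+ (points n) (λ x → ⟦ sat A x ⟧ * D) (λ _ → c)) ⟩
    (∑ (points n) (λ x → ⟦ sat A x ⟧ * D) + ∑ (points n) (λ _ → c)) * p
      ≡⟨ cong (_* p) (cong₂ _+_ (sym (∑-*ʳ (points n) (⟦_⟧ ∘ sat A) D))
           (trans (∑-replicate (points n) c) (cong (_* c) (length-points n)))) ⟩
    (∑ (points n) (⟦_⟧ ∘ sat A) * D + 3 ^ n * c) * p
      ≡⟨ lemma₁ (∑ (points n) (⟦_⟧ ∘ sat A)) D (3 ^ n) c p ⟩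
    (∑ (points n) (⟦_⟧ ∘ sat A) * p) * D + 3 ^ n * (c * p)
      ≤⟨ +-mono-≤ (≤-reflexive (cong (_* D) (∣sat∣ A))) (*-monoʳ-≤ (3 ^ n) (∣seen∣ m A)) ⟩
    3 ^ n * D + 3 ^ n * (m * D)
      ≡⟨ lemma₂ (3 ^ n) D m ⟩
    suc m * (3 ^ n * D) ∎
    where
    open ≤-Reasoning
    p = 3 ^ ∣ A ∣
    D = (3 ^ n) ^ m
    c = ∑ (vectors (points n) m) (⟦_⟧ ∘ seen A)
    ⟦∨⟧≤ : ∀ a b → ⟦ a ∨ b ⟧ ≤ ⟦ a ⟧ + ⟦ b ⟧
    ⟦∨⟧≤ true  b = m≤m+n 1 ⟦ b ⟧
    ⟦∨⟧≤ false b = ≤-refl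
    lemma₁ : ∀ x D M c p → (x * D + M * c) * p ≡ (x * p) * D + M * (c * p)
    lemma₁ = solve-∀
    lemma₂ : ∀ M D m → M * D + M * (m * D) ≡ suc m * (M * D)
    lemma₂ = solve-∀

-- Order, finite sums and probabilities for rational sequences

module Reals where
  open import Algebra.Bundles using (CommutativeMonoid)
  open import Data.Bool.Base using (Bool; true; false; not; if_then_else_)
  open import Data.Fin.Base using (Fin; zero; suc)
  open import Data.Integer.Base as ℤ using (+_)
  import Data.Integer.Properties as ℤₚ
  open import Data.List.Base as List using (List; []; _∷_)
  open import Data.Nat.Base as ℕ using (ℕ; zero; suc; z≤n; s≤s)
  import Data.Nat.Properties as ℕₚ
  open import Data.Nat.Tactic.RingSolver using (solve-∀)
  open import Data.Product.Base using (_,_; proj₁)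
  open import Data.Rational.Base as ℚ using (ℚ; 0ℚ; 1ℚ; ½; _/_)
  import Data.Rational.Properties as ℚₚ
  open import Data.Rational.Solver using (module +-*-Solver)
  open import Data.Rational.Unnormalised.Base as ℚᵘ using (mkℚᵘ; *≡*)
  import Data.Rational.Unnormalised.Properties as ℚᵘₚ
  open import Data.Vec.Functional using (Vector)
  open import Defs using (Eventually; ℝ; seq; Distribution; IsWeighting; prob)
  import Defs
  open import Function.Base using (_∘_)
  open import Level using (0ℓ)
  open import Relation.Binary.Bundles using (Preorder)
  import Relation.Binary.Reasoning.Preorder
  open import Relation.Binary.PropositionalEquality using (_≡_; refl; sym; trans; cong; cong₂; subst; subst₂)
  open import Relation.Nullary using (¬_; contradiction)

  infix  4 _≐_ _≼_
  infixl 6 _⊕_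

  -- The order of ℝ only depends on the underlying sequences, so inequalities
  -- between reals are derived in the monoid of all rational sequences.
  -- Eta-equality would make the type checker unfold sums when it infers
  -- arguments.
  record Seq : Set where
    no-eta-equality
    constructor ⟨_⟩
    field at : ℕ → ℚ
  open Seq public

  _⊕_ : Seq → Seq → Seq
  (x ⊕ y) .at k = at x k ℚ.+ at y k

  const : ℚ → Seq
  const q .at _ = q

  𝟘 𝟙 : Seq
  𝟘 = const 0ℚ
  𝟙 = const 1ℚ

  -- Equality at every index is finer than equality of reals, but it is enough here: sums are only
  -- rearranged by laws that hold exactly in ℚ. As a record it lets both sides be inferred.
  record _≐_ (x y : Seq) : Set where
    constructor pointwise
    field eq-at : ∀ k → at x k ≡ at y k
  open _≐_ public

  record _≼_ (x y : Seq) : Set where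
    constructor wrap
    field unwrap : ∀ δ → 0ℚ ℚ.< δ → Eventually (λ k → at x k ℚ.≤ at y k ℚ.+ δ)
  open _≼_ public

  Seq-commutativeMonoid : CommutativeMonoid 0ℓ 0ℓ
  Seq-commutativeMonoid = record
    { Carrier = Seq ; _≈_ = _≐_ ; _∙_ = _⊕_ ; ε = 𝟘
    ; isCommutativeMonoid = record
      { isMonoid = record
        { isSemigroup = record
          { isMagma = record
            { isEquivalence = record
              { refl  = pointwise λ _ → refl
              ; sym   = λ p → pointwise λ k → sym (eq-at p k)
              ; trans = λ p q → pointwise λ k → trans (eq-at p k) (eq-at q k)
              }
            ; ∙-cong = λ p q → pointwise λ k → cong₂ ℚ._+_ (eq-at p k) (eq-at q k)
            }
          ; assoc = λ x y z → pointwise λ k → ℚₚ.+-assoc (at x k) (at y k) (at z k)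
          }
        ; identity = (λ x → pointwise λ k → ℚₚ.+-identityˡ (at x k))
                   , (λ x → pointwise λ k → ℚₚ.+-identityʳ (at x k))
        }
      ; comm = λ x y → pointwise λ k → ℚₚ.+-comm (at x k) (at y k)
      }
    }

  open CommutativeMonoid Seq-commutativeMonoid public using ()
    renaming (refl to ≐-refl; sym to ≐-sym; trans to ≐-trans;
              ∙-cong to ⊕-cong; ∙-congˡ to ⊕-congˡ; ∙-congʳ to ⊕-congʳ;
              identityˡ to ⊕-identityˡ; identityʳ to ⊕-identityʳ;
              commutativeSemigroup to ⊕-commutativeSemigroup; isEquivalence to ≐-isEquivalence)

  half>0 : ∀ {δ} → 0ℚ ℚ.< δ → 0ℚ ℚ.< ½ ℚ.* δ
  half>0 = ℚₚ.*-monoʳ-<-pos ½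

  half+half : ∀ δ → ½ ℚ.* δ ℚ.+ ½ ℚ.* δ ≡ δ
  half+half δ = trans (sym (ℚₚ.*-distribʳ-+ δ ½ ½)) (ℚₚ.*-identityˡ δ)

  p≤p+δ : ∀ p {δ} → 0ℚ ℚ.< δ → p ℚ.≤ p ℚ.+ δ
  p≤p+δ p {δ} 0<δ = subst (ℚ._≤ p ℚ.+ δ) (ℚₚ.+-identityʳ p) (ℚₚ.+-monoʳ-≤ p (ℚₚ.<⇒≤ 0<δ))

  ≼-reflexive : ∀ {x y} → x ≐ y → x ≼ y
  ≼-reflexive {x} {y} x≐y .unwrap δ 0<δ = 0 , λ k _ →
    subst (ℚ._≤ at y k ℚ.+ δ) (sym (eq-at x≐y k)) (p≤p+δ (at y k) 0<δ)

  ≼-trans : ∀ {x y z} → x ≼ y → y ≼ z → x ≼ z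
  ≼-trans {x} {y} {z} (wrap x≤y) (wrap y≤z) .unwrap δ 0<δ =
    let K , p = x≤y (½ ℚ.* δ) (half>0 0<δ)
        L , q = y≤z (½ ℚ.* δ) (half>0 0<δ)
    in K ℕ.⊔ L , λ k k≥ → begin
      at x k                                 ≤⟨ p k (ℕₚ.m⊔n≤o⇒m≤o K L k≥) ⟩
      at y k ℚ.+ ½ ℚ.* δ                     ≤⟨ ℚₚ.+-monoˡ-≤ (½ ℚ.* δ) (q k (ℕₚ.m⊔n≤o⇒n≤o K L k≥)) ⟩
      at z k ℚ.+ ½ ℚ.* δ ℚ.+ ½ ℚ.* δ         ≡⟨ ℚₚ.+-assoc (at z k) (½ ℚ.* δ) (½ ℚ.* δ) ⟩
      at z k ℚ.+ (½ ℚ.* δ ℚ.+ ½ ℚ.* δ)       ≡⟨ cong (at z k ℚ.+_) (half+half δ) ⟩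
      at z k ℚ.+ δ                           ∎
    where open ℚₚ.≤-Reasoning

  ⊕-mono-≼ : ∀ {x y u v} → x ≼ y → u ≼ v → x ⊕ u ≼ y ⊕ v
  ⊕-mono-≼ {x} {y} {u} {v} (wrap x≤y) (wrap u≤v) .unwrap δ 0<δ =
    let K , p = x≤y (½ ℚ.* δ) (half>0 0<δ)
        L , q = u≤v (½ ℚ.* δ) (half>0 0<δ)
    in K ℕ.⊔ L , λ k k≥ → begin
      at x k ℚ.+ at u k
        ≤⟨ ℚₚ.+-mono-≤ (p k (ℕₚ.m⊔n≤o⇒m≤o K L k≥)) (q k (ℕₚ.m⊔n≤o⇒n≤o K L k≥)) ⟩
      (at y k ℚ.+ ½ ℚ.* δ) ℚ.+ (at v k ℚ.+ ½ ℚ.* δ)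
        ≡⟨ rearrange (at y k) (at v k) (½ ℚ.* δ) ⟩
      (at y k ℚ.+ at v k) ℚ.+ (½ ℚ.* δ ℚ.+ ½ ℚ.* δ)
        ≡⟨ cong (at y k ℚ.+ at v k ℚ.+_) (half+half δ) ⟩
      (at y k ℚ.+ at v k) ℚ.+ δ ∎
    where
    open ℚₚ.≤-Reasoning
    open +-*-Solver
    rearrange : ∀ a b d → (a ℚ.+ d) ℚ.+ (b ℚ.+ d) ≡ (a ℚ.+ b) ℚ.+ (d ℚ.+ d)
    rearrange = solve 3 (λ a b d → (a :+ d) :+ (b :+ d) := (a :+ b) :+ (d :+ d)) refl

  ≼-preorder : Preorder 0ℓ 0ℓ 0ℓ
  ≼-preorder = record
    { Carrier = Seq ; _≈_ = _≐_ ; _≲_ = _≼_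
    ; isPreorder = record
      { isEquivalence = ≐-isEquivalence ; reflexive = ≼-reflexive ; trans = ≼-trans }
    }

  open import Algebra.Properties.CommutativeMonoid.Mult Seq-commutativeMonoid public renaming (_×_ to _·_)
  open import Algebra.Properties.CommutativeSemigroup ⊕-commutativeSemigroup using (interchange)
  open import Algebra.Properties.CommutativeMonoid.Sum Seq-commutativeMonoid public
    using (sum; sum-replicate-zero) renaming (∑-distrib-+ to sum-distrib-⊕; sum-cong-≋ to sum-cong)
  open ListSum Seq-commutativeMonoid public

  module ≼-Reasoning = Relation.Binary.Reasoning.Preorder ≼-preorder

  ≼-refl : ∀ {x} → x ≼ x
  ≼-refl = ≼-reflexive ≐-refl

  ×-monoʳ-≼ : ∀ n {x y} → x ≼ y → n · x ≼ n · y
  ×-monoʳ-≼ zero    x≼y = ≼-refl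
  ×-monoʳ-≼ (suc n) x≼y = ⊕-mono-≼ x≼y (×-monoʳ-≼ n x≼y)

  ×-nonNeg : ∀ n {x} → 𝟘 ≼ x → 𝟘 ≼ n · x
  ×-nonNeg zero    0≼x = ≼-refl
  ×-nonNeg (suc n) 0≼x = ≼-trans (≼-reflexive (≐-sym (⊕-identityˡ 𝟘))) (⊕-mono-≼ 0≼x (×-nonNeg n 0≼x))

  ×-monoˡ-≼ : ∀ {m n x} → 𝟘 ≼ x → m ℕ.≤ n → m · x ≼ n · x
  ×-monoˡ-≼ {n = n} 0≼x z≤n = ×-nonNeg n 0≼x
  ×-monoˡ-≼ 0≼x (s≤s m≤n) = ⊕-mono-≼ ≼-refl (×-monoˡ-≼ 0≼x m≤n)

  const-mono : ∀ {p q} → p ℚ.≤ q → const p ≼ const q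
  const-mono {p} {q} p≤q .unwrap δ 0<δ = 0 , λ _ _ → ℚₚ.≤-trans p≤q (p≤p+δ q 0<δ)

  p≤q+δ⇒p≤q : ∀ p q → (∀ δ → 0ℚ ℚ.< δ → p ℚ.≤ q ℚ.+ δ) → p ℚ.≤ q
  p≤q+δ⇒p≤q p q h = ℚₚ.≮⇒≥ λ q<p →
    let m , q<m , m<p = ℚₚ.<-dense q<p in
    ℚₚ.<-irrefl refl (ℚₚ.<-≤-trans m<p (ℚₚ.≤-trans
      (h (m ℚ.- q) (subst (ℚ._< m ℚ.- q) (ℚₚ.+-inverseʳ q) (ℚₚ.+-monoˡ-< (ℚ.- q) q<m)))
      (ℚₚ.≤-reflexive (rearrange q m))))
    where
    open +-*-Solver
    rearrange : ∀ q m → q ℚ.+ (m ℚ.- q) ≡ m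
    rearrange = solve 2 (λ q m → q :+ (m :- q) := m) refl

  const-cancel : ∀ {p q} → const p ≼ const q → p ℚ.≤ q
  const-cancel {p} {q} (wrap p≤q) = p≤q+δ⇒p≤q p q λ δ 0<δ →
    let K , h = p≤q δ 0<δ in h K ℕₚ.≤-refl

  0≼1 : 𝟘 ≼ 𝟙
  0≼1 = const-mono (ℚₚ.<⇒≤ (ℚₚ.positive⁻¹ 1ℚ))

  1⋠0 : ¬ (𝟙 ≼ 𝟘)
  1⋠0 1≼0 = ℚₚ.<-irrefl refl (ℚₚ.<-≤-trans (ℚₚ.positive⁻¹ 1ℚ) (const-cancel 1≼0))

  ⊕-cancelˡ-≼ : ∀ z {x y} → z ⊕ x ≼ z ⊕ y → x ≼ y
  ⊕-cancelˡ-≼ z {x} {y} (wrap h) .unwrap δ 0<δ = let K , p = h δ 0<δ in K , λ k k≥ →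
    subst₂ ℚ._≤_ (rearrange₁ (at z k) (at x k)) (rearrange₂ (at z k) (at y k) δ)
      (ℚₚ.+-monoʳ-≤ (ℚ.- at z k) (p k k≥))
    where
    open +-*-Solver
    rearrange₁ : ∀ z x → ℚ.- z ℚ.+ (z ℚ.+ x) ≡ x
    rearrange₁ = solve 2 (λ z x → :- z :+ (z :+ x) := x) refl
    rearrange₂ : ∀ z y d → ℚ.- z ℚ.+ (z ℚ.+ y ℚ.+ d) ≡ y ℚ.+ d
    rearrange₂ = solve 3 (λ z y d → :- z :+ (z :+ y :+ d) := y :+ d) refl

  -- The way back to ℕ: the whole averaging argument ends in an inequality between two multiples of
  -- `𝟙`. Cancelling copies of `𝟙` can only fail by leaving 1 ≤ 0.
  ×1-cancel : ∀ m n → m · 𝟙 ≼ n · 𝟙 → m ℕ.≤ n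
  ×1-cancel zero    n       _ = z≤n
  ×1-cancel (suc m) zero    h = contradiction (≼-trans 1≼1+m h) 1⋠0
    where
    1≼1+m : 𝟙 ≼ 𝟙 ⊕ m · 𝟙
    1≼1+m = ≼-trans (≼-reflexive (≐-sym (⊕-identityʳ 𝟙))) (⊕-mono-≼ ≼-refl (×-nonNeg m 0≼1))
  ×1-cancel (suc m) (suc n) h = s≤s (×1-cancel m n (⊕-cancelˡ-≼ 𝟙 h))

  ∑-mono-≼ : ∀ {A : Set} (xs : List A) {f g} → (∀ x → f x ≼ g x) → ∑ xs f ≼ ∑ xs g
  ∑-mono-≼ []       f≼g = ≼-refl
  ∑-mono-≼ (x ∷ xs) f≼g = ⊕-mono-≼ (f≼g x) (∑-mono-≼ xs f≼g)

  ×-zeroʳ : ∀ n → n · 𝟘 ≐ 𝟘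
  ×-zeroʳ zero    = ≐-refl
  ×-zeroʳ (suc n) = ≐-trans (⊕-identityˡ _) (×-zeroʳ n)

  ∑-× : ∀ {A : Set} n (xs : List A) f → n · ∑ xs f ≐ ∑ xs (λ x → n · f x)
  ∑-× n []       f = ×-zeroʳ n
  ∑-× n (x ∷ xs) f = ≐-trans (×-distrib-+ (f x) (∑ xs f) n) (⊕-congˡ (∑-× n xs f))

  module ∑ℕ = ListSum ℕₚ.+-0-commutativeMonoid
  open Counting using (⟦_⟧)

  ∑-×ˡ : ∀ {A : Set} (xs : List A) f x → ∑ xs (λ a → f a · x) ≐ ∑ℕ.∑ xs f · x
  ∑-×ˡ []       f x = ≐-refl
  ∑-×ˡ (a ∷ xs) f x = ≐-trans (⊕-congˡ (∑-×ˡ xs f x)) (≐-sym (×-homo-+ x (f a) _))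

  if≐× : ∀ b x → (if b then x else 𝟘) ≐ ⟦ b ⟧ · x
  if≐× true  x = ≐-sym (⊕-identityʳ x)
  if≐× false x = ≐-refl

  sum-mono-≼ : ∀ {k} {f g : Vector Seq k} → (∀ i → f i ≼ g i) → sum f ≼ sum g
  sum-mono-≼ {zero}  f≼g = ≼-refl
  sum-mono-≼ {suc k} f≼g = ⊕-mono-≼ (f≼g zero) (sum-mono-≼ (f≼g ∘ suc))

  ι : ℝ → Seq
  ι x .at = seq x

  ι-sum : ∀ {k} (w : Vector ℝ k) → ι (Defs.sum w) ≐ sum (ι ∘ w)
  ι-sum {zero}  w = pointwise λ _ → refl
  ι-sum {suc k} w = pointwise λ j → cong (seq (w zero) j ℚ.+_) (eq-at (ι-sum (w ∘ suc)) j)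

  private variable
    A B : Set

  ι-∑ : ∀ (xs : List A) f → ι (List.foldr Defs._+_ Defs.0ℝ (List.map f xs)) ≐ ∑ xs (ι ∘ f)
  ι-∑ []       f = pointwise λ _ → refl
  ι-∑ (x ∷ xs) f = pointwise λ k → cong (seq (f x) k ℚ.+_) (eq-at (ι-∑ xs f) k)

  probSeq : Distribution A → (A → Bool) → Seq
  probSeq μ E = sum (λ i → if E (outcome i) then ι (weight i) else 𝟘)
    where open Distribution μ

  ι-prob : ∀ (μ : Distribution A) E → ι (prob μ E) ≐ probSeq μ E
  ι-prob μ E = ≐-trans (ι-sum (λ i → if E (outcome i) then weight i else Defs.0ℝ)) (sum-cong branch)
    where
    open Distribution μ
    branch : ∀ i → ι (if E (outcome i) then weight i else Defs.0ℝ) ≐ (if E (outcome i) then ι (weight i) else 𝟘)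
    branch i with E (outcome i)
    ... | true  = ≐-refl
    ... | false = pointwise λ _ → refl

  module _ (μ : Distribution A) where
    open Distribution μ
    open IsWeighting isWeighting

    private
      w : Vector Seq size
      w = ι ∘ weight

      0≼w : ∀ i → 𝟘 ≼ w i
      0≼w i = wrap (nonNegative i)

    ∑w≼1 : sum w ≼ 𝟙
    ∑w≼1 = ≼-trans (≼-reflexive (≐-sym (ι-sum weight))) (wrap (proj₁ total))

    prob≼1 : ∀ E → probSeq μ E ≼ 𝟙
    prob≼1 E = ≼-trans (sum-mono-≼ below) ∑w≼1
      where
      below : ∀ i → (if E (outcome i) then w i else 𝟘) ≼ w i
      below i with E (outcome i)
      ... | true  = ≼-refl
      ... | false = 0≼w i

    prob-complement : ∀ E F → (∀ U → F U ≡ not (E U)) → probSeq μ E ⊕ probSeq μ F ≼ 𝟙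
    prob-complement E F F≡¬E = ≼-trans (≼-reflexive (≐-trans
      (≐-sym (sum-distrib-⊕ (λ i → if E (outcome i) then w i else 𝟘) (λ i → if F (outcome i) then w i else 𝟘)))
      (sum-cong split))) ∑w≼1
      where
      split : ∀ i → (if E (outcome i) then w i else 𝟘) ⊕ (if F (outcome i) then w i else 𝟘) ≐ w i
      split i rewrite F≡¬E (outcome i) with E (outcome i)
      ... | true  = ⊕-identityʳ (w i)
      ... | false = ⊕-identityˡ (w i)

    -- Linearity of expectation: an outcome U in E has weight counted r times on the left, and at
    -- least r - e times among the events F y. The loss e is charged to the total weight, which is
    -- at most 1.
    ×-prob≼ : ∀ (E : A → Bool) (F : B → A → Bool) ys r e →
      (∀ U → E U ≡ true → r ℕ.≤ ∑ℕ.∑ ys (λ y → ⟦ F y U ⟧) ℕ.+ e) →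
      r · probSeq μ E ≼ ∑ ys (λ y → probSeq μ (F y)) ⊕ e · 𝟙
    ×-prob≼ E F ys r e h = ≼-trans (bound w outcome 0≼w) (⊕-mono-≼ ≼-refl (×-monoʳ-≼ e ∑w≼1))
      where
      bound : ∀ {k} (w : Vector Seq k) (o : Vector A k) → (∀ i → 𝟘 ≼ w i) →
        r · sum (λ i → if E (o i) then w i else 𝟘) ≼
        ∑ ys (λ y → sum (λ i → if F y (o i) then w i else 𝟘)) ⊕ e · sum w
      bound {zero} w o _ = begin
        r · 𝟘                    ≈⟨ ×-zeroʳ r ⟩
        𝟘                        ≈⟨ ⊕-identityˡ 𝟘 ⟨
        𝟘 ⊕ 𝟘                   ≈⟨ ⊕-cong (∑-zero ys) (×-zeroʳ e) ⟨
        ∑ ys (λ _ → 𝟘) ⊕ e · 𝟘  ∎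
        where
        open ≼-Reasoning
      bound {suc k} w o 0≼w = begin
        r · (a ⊕ s)
          ≈⟨ ×-distrib-+ a s r ⟩
        r · a ⊕ r · s
          ≲⟨ ⊕-mono-≼ first (bound (w ∘ suc) (o ∘ suc) (0≼w ∘ suc)) ⟩
        (∑ ys f ⊕ e · w zero) ⊕ (∑ ys g ⊕ e · sum (w ∘ suc))
          ≈⟨ interchange _ _ _ _ ⟩
        (∑ ys f ⊕ ∑ ys g) ⊕ (e · w zero ⊕ e · sum (w ∘ suc))
          ≈⟨ ⊕-cong (∑-distrib-+ ys f g) (×-distrib-+ (w zero) _ e) ⟨
        ∑ ys (λ y → f y ⊕ g y) ⊕ e · sum w ∎
        where
        open ≼-Reasoning
        U = o zero
        a = if E U then w zero else 𝟘
        s = sum (λ i → if E (o (suc i)) then w (suc i) else 𝟘)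
        f = λ y → if F y U then w zero else 𝟘
        g = λ y → sum (λ i → if F y (o (suc i)) then w (suc i) else 𝟘)
        agreements : ∑ℕ.∑ ys (λ y → ⟦ F y U ⟧) · w zero ⊕ e · w zero ≐ ∑ ys f ⊕ e · w zero
        agreements = ⊕-congʳ (≐-trans (≐-sym (∑-×ˡ ys (λ y → ⟦ F y U ⟧) (w zero)))
          (∑-cong ys (λ y → ≐-sym (if≐× (F y U) (w zero)))))
        first : r · a ≼ ∑ ys f ⊕ e · w zero
        first with E U in eq
        ... | true = begin
          r · w zero                                          ≲⟨ ×-monoˡ-≼ (0≼w zero) (h U eq) ⟩
          (∑ℕ.∑ ys (λ y → ⟦ F y U ⟧) ℕ.+ e) · w zero
            ≈⟨ ×-homo-+ (w zero) (∑ℕ.∑ ys (λ y → ⟦ F y U ⟧)) e ⟩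
          ∑ℕ.∑ ys (λ y → ⟦ F y U ⟧) · w zero ⊕ e · w zero     ≈⟨ agreements ⟩
          ∑ ys f ⊕ e · w zero                                 ∎
        ... | false = begin
          r · 𝟘                                              ≈⟨ ×-zeroʳ r ⟩
          𝟘                                                  ≲⟨ ×-nonNeg (∑ℕ.∑ ys (λ y → ⟦ F y U ⟧) ℕ.+ e) (0≼w zero) ⟩
          (∑ℕ.∑ ys (λ y → ⟦ F y U ⟧) ℕ.+ e) · w zero
            ≈⟨ ×-homo-+ (w zero) (∑ℕ.∑ ys (λ y → ⟦ F y U ⟧)) e ⟩
          ∑ℕ.∑ ys (λ y → ⟦ F y U ⟧) · w zero ⊕ e · w zero     ≈⟨ agreements ⟩
          ∑ ys f ⊕ e · w zero                                 ∎

  toℚᵘ-/ : ∀ i d .{{_ : ℕ.NonZero d}} → ℚ.toℚᵘ (i / d) ℚᵘ.≃ (i ℚᵘ./ d)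
  toℚᵘ-/ i (suc d) = ℚₚ.toℚᵘ-fromℚᵘ (mkℚᵘ i d)

  /1-suc : ∀ n → 1ℚ ℚ.+ (+ n / 1) ≡ + suc n / 1
  /1-suc n = ℚₚ.toℚᵘ-injective (begin-equality
    ℚ.toℚᵘ (1ℚ ℚ.+ (+ n / 1))            ≃⟨ ℚₚ.toℚᵘ-homo-+ 1ℚ (+ n / 1) ⟩
    ℚᵘ.1ℚᵘ ℚᵘ.+ ℚ.toℚᵘ (+ n / 1)         ≃⟨ ℚᵘₚ.+-congʳ ℚᵘ.1ℚᵘ (toℚᵘ-/ (+ n) 1) ⟩
    ℚᵘ.1ℚᵘ ℚᵘ.+ mkℚᵘ (+ n) 0             ≃⟨ *≡* (cong (λ i → (+ 1 ℤ.+ i) ℤ.* + 1) (ℤₚ.*-identityʳ (+ n))) ⟩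
    mkℚᵘ (+ suc n) 0                     ≃⟨ toℚᵘ-/ (+ suc n) 1 ⟨
    ℚ.toℚᵘ (+ suc n / 1)                 ∎)
    where open ℚᵘₚ.≤-Reasoning

  at-× : ∀ n x k → at (n · x) k ≡ (+ n / 1) ℚ.* at x k
  at-× zero    x k = sym (ℚₚ.*-zeroˡ (at x k))
  at-× (suc n) x k = begin-equality
    at x k ℚ.+ at (n · x) k                    ≡⟨ cong (at x k ℚ.+_) (at-× n x k) ⟩
    at x k ℚ.+ (+ n / 1) ℚ.* at x k
      ≡⟨ cong (ℚ._+ (+ n / 1) ℚ.* at x k) (ℚₚ.*-identityˡ (at x k)) ⟨
    1ℚ ℚ.* at x k ℚ.+ (+ n / 1) ℚ.* at x k     ≡⟨ ℚₚ.*-distribʳ-+ (at x k) 1ℚ (+ n / 1) ⟨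
    (1ℚ ℚ.+ (+ n / 1)) ℚ.* at x k              ≡⟨ cong (ℚ._* at x k) (/1-suc n) ⟩
    (+ suc n / 1) ℚ.* at x k                   ∎
    where open ℚₚ.≤-Reasoning

  /1*/ : ∀ a b c d .{{_ : ℕ.NonZero d}} → a ℕ.* b ≡ c ℕ.* d →
    (+ a / 1) ℚ.* (+ b / d) ≡ + c / 1
  /1*/ a b c d@(suc d-1) ab≡cd = ℚₚ.toℚᵘ-injective (begin-equality
    ℚ.toℚᵘ ((+ a / 1) ℚ.* (+ b / d))             ≃⟨ ℚₚ.toℚᵘ-homo-* (+ a / 1) (+ b / d) ⟩
    ℚ.toℚᵘ (+ a / 1) ℚᵘ.* ℚ.toℚᵘ (+ b / d)       ≃⟨ ℚᵘₚ.*-cong (toℚᵘ-/ (+ a) 1) (toℚᵘ-/ (+ b) d) ⟩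
    mkℚᵘ (+ a) 0 ℚᵘ.* mkℚᵘ (+ b) d-1             ≃⟨ *≡* cross ⟩
    mkℚᵘ (+ c) 0                                 ≃⟨ toℚᵘ-/ (+ c) 1 ⟨
    ℚ.toℚᵘ (+ c / 1)                             ∎)
    where
    open ℚᵘₚ.≤-Reasoning
    cross : + a ℤ.* + b ℤ.* + 1 ≡ + c ℤ.* + (1 ℕ.* d)
    cross = trans (ℤₚ.*-identityʳ (+ a ℤ.* + b)) (trans (sym (ℤₚ.pos-* a b))
      (trans (cong +_ (trans ab≡cd (cong (c ℕ.*_) (sym (ℕₚ.*-identityˡ d))))) (ℤₚ.pos-* c (1 ℕ.* d))))

  -- Clears both denominators of a success guarantee: x is the sum of the success probabilities over
  -- the D possible samples, and y is their mean.
  2/3≼x/D⇒2D≼3x : ∀ D .{{_ : ℕ.NonZero D}} x y → (∀ k → at y k ≡ (+ 1 / D) ℚ.* at x k) →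
    const (+ 2 / 3) ≼ y → (2 ℕ.* D) · 𝟙 ≼ 3 · x
  2/3≼x/D⇒2D≼3x D x y y≡x/D h = begin
    (2 ℕ.* D) · 𝟙                   ≈⟨ pointwise left ⟩
    (3 ℕ.* D) · const (+ 2 / 3)     ≲⟨ ×-monoʳ-≼ (3 ℕ.* D) h ⟩
    (3 ℕ.* D) · y                   ≈⟨ pointwise right ⟩
    3 · x                           ∎
    where
    open ≼-Reasoning
    left : ∀ k → at ((2 ℕ.* D) · 𝟙) k ≡ at ((3 ℕ.* D) · const (+ 2 / 3)) k
    left k = trans (at-× (2 ℕ.* D) 𝟙 k) (trans (ℚₚ.*-identityʳ (+ (2 ℕ.* D) / 1))
      (trans (sym (/1*/ (3 ℕ.* D) 2 (2 ℕ.* D) 3 (lemma D))) (sym (at-× (3 ℕ.* D) (const (+ 2 / 3)) k))))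
      where
      lemma : ∀ D → 3 ℕ.* D ℕ.* 2 ≡ 2 ℕ.* D ℕ.* 3
      lemma = solve-∀
    right : ∀ k → at ((3 ℕ.* D) · y) k ≡ at (3 · x) k
    right k = trans (at-× (3 ℕ.* D) y k)
      (trans (cong ((+ (3 ℕ.* D) / 1) ℚ.*_) (y≡x/D k))
      (trans (sym (ℚₚ.*-assoc (+ (3 ℕ.* D) / 1) (+ 1 / D) (at x k)))
      (trans (cong (ℚ._* at x k) (/1*/ (3 ℕ.* D) 1 3 D (ℕₚ.*-identityʳ (3 ℕ.* D)))) (sym (at-× 3 x k)))))

  /≤/⇒*≤* : ∀ a b c d .{{_ : ℕ.NonZero b}} .{{_ : ℕ.NonZero d}} →
    (+ a / b) ℚ.≤ (+ c / d) → a ℕ.* d ℕ.≤ c ℕ.* b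
  /≤/⇒*≤* a b@(suc _) c d@(suc _) h = ℤₚ.drop‿+≤+ (begin
    + (a ℕ.* d)      ≡⟨ ℤₚ.pos-* a d ⟩
    + a ℤ.* + d
      ≤⟨ ℚᵘₚ.drop-*≤* (ℚᵘₚ.≤-respʳ-≃ (toℚᵘ-/ (+ c) d) (ℚᵘₚ.≤-respˡ-≃ (toℚᵘ-/ (+ a) b) (ℚₚ.toℚᵘ-mono-≤ h))) ⟩
    + c ℤ.* + b      ≡⟨ ℤₚ.pos-* c b ⟨
    + (c ℕ.* b)      ∎)
    where open ℤₚ.≤-Reasoning

  fromℚ<≤⇒≤ : ∀ {p q} y → Defs.fromℚ p Defs.< y → y Defs.≤ Defs.fromℚ q → p ℚ.≤ q
  fromℚ<≤⇒≤ {p} {q} y (δ , 0<δ , K , p+δ≤y) y≤q = const-cancel (≼-trans {const p} {ι y} {const q} p≼y (wrap y≤q))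
    where
    p≼y : const p ≼ ι y
    p≼y .unwrap δ′ 0<δ′ = K , λ k K≤k →
      ℚₚ.≤-trans (p≤p+δ p 0<δ) (ℚₚ.≤-trans (p+δ≤y k K≤k) (p≤p+δ (seq y k) 0<δ′))

  /-* : ∀ a b c d .{{_ : ℕ.NonZero b}} .{{_ : ℕ.NonZero d}} →
    (+ a / b) ℚ.* (+ c / d) ≡ (+ (a ℕ.* c) / (b ℕ.* d)) {{ℕₚ.m*n≢0 b d}}
  /-* a b@(suc b-1) c d@(suc d-1) = ℚₚ.toℚᵘ-injective (begin-equality
    ℚ.toℚᵘ ((+ a / b) ℚ.* (+ c / d))             ≃⟨ ℚₚ.toℚᵘ-homo-* (+ a / b) (+ c / d) ⟩
    ℚ.toℚᵘ (+ a / b) ℚᵘ.* ℚ.toℚᵘ (+ c / d)       ≃⟨ ℚᵘₚ.*-cong (toℚᵘ-/ (+ a) b) (toℚᵘ-/ (+ c) d) ⟩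
    mkℚᵘ (+ a) b-1 ℚᵘ.* mkℚᵘ (+ c) d-1           ≃⟨ *≡* (cong (ℤ._* + (b ℕ.* d)) (sym (ℤₚ.pos-* a c))) ⟩
    mkℚᵘ (+ (a ℕ.* c)) (ℕ.pred (b ℕ.* d))        ≃⟨ toℚᵘ-/ (+ (a ℕ.* c)) (b ℕ.* d) ⟨
    ℚ.toℚᵘ (+ (a ℕ.* c) / (b ℕ.* d))             ∎)
    where open ℚᵘₚ.≤-Reasoning

  r²≤n/64 : ∀ a b n → let r = Defs.fromℚ (+ a / suc b) ; c = Defs.fromℚ (+ 1 / 8) in
    r Defs.* r Defs.≤ c Defs.* c Defs.* Defs.fromℚ (+ n / 1) → a ℕ.* a ℕ.* 64 ℕ.≤ n ℕ.* (suc b ℕ.* suc b)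
  r²≤n/64 a b n h = ℕₚ.≤-trans
    (/≤/⇒*≤* (a ℕ.* a) (suc b ℕ.* suc b) (1 ℕ.* n) (64 ℕ.* 1)
      (subst₂ ℚ._≤_ (/-* a (suc b) a (suc b)) (/-* 1 64 n 1)
      (const-cancel {(+ a / suc b) ℚ.* (+ a / suc b)} {(+ 1 / 8) ℚ.* (+ 1 / 8) ℚ.* (+ n / 1)} (wrap h))))
    (ℕₚ.≤-reflexive (cong (ℕ._* (suc b ℕ.* suc b)) (ℕₚ.*-identityˡ n)))

-- Convexity of the concepts

module Convexity where
  open import Data.Bool.Base using (Bool; true; false; T)
  open import Data.Fin.Base using (Fin; zero; suc)
  open import Data.Nat.Base as ℕ using (ℕ; zero; suc)
  import Data.Nat.Properties as ℕₚ
  open import Data.Product.Base using (∃-syntax; _×_; _,_; proj₁; proj₂)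
  open import Data.Rational.Base as ℚ using (ℚ; 0ℚ; 1ℚ; ∣_∣)
  import Data.Rational.Properties as ℚₚ
  open import Data.Rational.Solver using (module +-*-Solver)
  open import Data.Sum.Base using (inj₁; inj₂)
  open import Data.Vec.Base as Vec using (Vec; []; _∷_; lookup)
  open import Data.Vec.Functional using (Vector)
  open import Defs using (ℝ; seq; cauchy; Cauchy; Eventually; Trit; -1ₜ; 0ₜ; 1ₜ; tritℝ;
    Point; embed; image; Conv; Convex; IsWeighting)
  import Defs
  open import Function.Base using (_∘_)
  open import Function.Bundles using (mk⇔)
  open import Relation.Binary.PropositionalEquality using (_≡_; _≢_; refl; sym; trans; cong; subst; subst₂)
  open import Relation.Nullary using (¬_; contradiction)
  open import Relation.Unary using (_∈_)
  open Counting using (sat)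
  open Concepts
  open Reals
  private variable
    n N : ℕ

  infixl 7 _⊛_

  -- The left factor stays a real: its Cauchy property bounds it, and this makes the product respect
  -- equality of the right factors as reals.
  _⊛_ : ℝ → Seq → Seq
  (w ⊛ y) .at k = seq w k ℚ.* at y k

  eventually-bounded : ∀ {s} → Cauchy s → ∃[ B ] 0ℚ ℚ.< B × Eventually (λ k → ∣ s k ∣ ℚ.≤ B)
  eventually-bounded {s} cs with cs 1ℚ (ℚₚ.positive⁻¹ 1ℚ)
  ... | K , p = 1ℚ ℚ.+ ∣ s K ∣ , ℚₚ.+-mono-<-≤ (ℚₚ.positive⁻¹ 1ℚ) (ℚₚ.0≤∣p∣ (s K)) , K , λ k K≤k → begin
      ∣ s k ∣                          ≡⟨ cong ∣_∣ (insert (s k) (s K)) ⟩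
      ∣ (s k ℚ.- s K) ℚ.+ s K ∣        ≤⟨ ℚₚ.∣p+q∣≤∣p∣+∣q∣ (s k ℚ.- s K) (s K) ⟩
      ∣ s k ℚ.- s K ∣ ℚ.+ ∣ s K ∣      ≤⟨ ℚₚ.+-monoˡ-≤ ∣ s K ∣ (p k K K≤k ℕₚ.≤-refl) ⟩
      1ℚ ℚ.+ ∣ s K ∣                   ∎
    where
    open ℚₚ.≤-Reasoning
    open +-*-Solver
    insert : ∀ a b → a ≡ (a ℚ.- b) ℚ.+ b
    insert = solve 2 (λ a b → a := (a :- b) :+ b) refl

  -- No sign is assumed for w, because a weight that is nonnegative as a real may still have
  -- negative entries in its sequence. Hence the two-sided hypothesis and the absolute value.
  *-close : ∀ w y z {η} → y ℚ.≤ z ℚ.+ η → z ℚ.≤ y ℚ.+ η → w ℚ.* y ℚ.≤ w ℚ.* z ℚ.+ ∣ w ∣ ℚ.* η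
  *-close w y z {η} y≤z z≤y with ℚₚ.∣p∣≡p∨∣p∣≡-p w
  ... | inj₁ eq = subst (w ℚ.* y ℚ.≤_) (trans (ℚₚ.*-distribˡ-+ w z η) (cong (λ u → w ℚ.* z ℚ.+ u ℚ.* η) (sym eq)))
    (ℚₚ.*-monoˡ-≤-nonNeg w {{subst ℚ.NonNegative eq (ℚₚ.∣-∣-nonNeg w)}} y≤z)
  ... | inj₂ eq = subst₂ ℚ._≤_ (rearrange₁ w y z)
    (trans (rearrange₂ w y z η) (cong (λ u → w ℚ.* z ℚ.+ u ℚ.* η) (sym eq)))
    (ℚₚ.+-monoʳ-≤ (w ℚ.* y ℚ.+ w ℚ.* z)
      (ℚₚ.*-monoˡ-≤-nonNeg (ℚ.- w) {{subst ℚ.NonNegative eq (ℚₚ.∣-∣-nonNeg w)}} z≤y))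
    where
    open +-*-Solver
    rearrange₁ : ∀ w y z → w ℚ.* y ℚ.+ w ℚ.* z ℚ.+ (ℚ.- w) ℚ.* z ≡ w ℚ.* y
    rearrange₁ = solve 3 (λ w y z → w :* y :+ w :* z :+ (:- w) :* z := w :* y) refl
    rearrange₂ : ∀ w y z η → w ℚ.* y ℚ.+ w ℚ.* z ℚ.+ (ℚ.- w) ℚ.* (y ℚ.+ η) ≡ w ℚ.* z ℚ.+ (ℚ.- w) ℚ.* η
    rearrange₂ = solve 4 (λ w y z η → w :* y :+ w :* z :+ (:- w) :* (y :+ η) := w :* z :+ (:- w) :* η) refl

  ⊛-cong-≼ : ∀ w {y z} → y ≼ z → z ≼ y → w ⊛ y ≼ w ⊛ z
  ⊛-cong-≼ w {y} {z} (wrap y≤z) (wrap z≤y) .unwrap δ 0<δ =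
    let B , 0<B , J , w≤B = eventually-bounded {seq w} (cauchy w)
        instance
          _ = ℚ.positive 0<B
          _ = ℚₚ.pos⇒nonZero B
        η = ℚ.1/ B ℚ.* δ
        0<η : 0ℚ ℚ.< η
        0<η = subst (ℚ._< η) (ℚₚ.*-zeroʳ (ℚ.1/ B)) (ℚₚ.*-monoʳ-<-pos (ℚ.1/ B) {{ℚₚ.1/pos⇒pos B}} 0<δ)
        Bη≡δ : B ℚ.* η ≡ δ
        Bη≡δ = trans (sym (ℚₚ.*-assoc B (ℚ.1/ B) δ)) (trans (cong (ℚ._* δ) (ℚₚ.*-inverseʳ B)) (ℚₚ.*-identityˡ δ))
        K , p = y≤z η 0<η
        L , q = z≤y η 0<η
    in J ℕ.⊔ (K ℕ.⊔ L) , λ k k≥ →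
      let k≥′ = ℕₚ.m⊔n≤o⇒n≤o J (K ℕ.⊔ L) k≥ in
      ℚₚ.≤-trans (*-close (seq w k) (at y k) (at z k) (p k (ℕₚ.m⊔n≤o⇒m≤o K L k≥′)) (q k (ℕₚ.m⊔n≤o⇒n≤o K L k≥′)))
        (ℚₚ.+-monoʳ-≤ (seq w k ℚ.* at z k) (subst (∣ seq w k ∣ ℚ.* η ℚ.≤_) Bη≡δ
          (ℚₚ.*-monoʳ-≤-nonNeg η {{ℚ.nonNegative (ℚₚ.<⇒≤ 0<η)}} (w≤B k (ℕₚ.m⊔n≤o⇒m≤o J (K ℕ.⊔ L) k≥)))))

  -- For t equal to 0 or -1 the product is at most 0 = w - w. The additive form is the gap that
  -- `sum-mono-gap` takes.
  ⊛-trit-≢1 : ∀ w t → 𝟘 ≼ ι w → t ≢ 1ₜ → w ⊛ ι (tritℝ t) ⊕ ι w ≼ ι w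
  ⊛-trit-≢1 w 1ₜ  0≼w t≢1 = contradiction refl t≢1
  ⊛-trit-≢1 w 0ₜ  0≼w _   = ≼-reflexive (pointwise λ k →
    trans (cong (ℚ._+ seq w k) (ℚₚ.*-zeroʳ (seq w k))) (ℚₚ.+-identityˡ (seq w k)))
  ⊛-trit-≢1 w -1ₜ 0≼w _   = ≼-trans (≼-reflexive (pointwise λ k → lemma (seq w k))) 0≼w
    where
    open +-*-Solver
    lemma : ∀ w → w ℚ.* (ℚ.- 1ℚ) ℚ.+ w ≡ 0ℚ
    lemma = solve 1 (λ w → w :* (:- con 1ℚ) :+ w := con 0ℚ) refl

  drop-⊕ : ∀ {x y z} → 𝟘 ≼ y → x ⊕ y ≼ z → x ≼ z
  drop-⊕ {x} 0≼y x+y≼z = ≼-trans (≼-reflexive (≐-sym (⊕-identityʳ x))) (≼-trans (⊕-mono-≼ ≼-refl 0≼y) x+y≼z)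

  ⊛-trit≼ : ∀ w t → 𝟘 ≼ ι w → w ⊛ ι (tritℝ t) ≼ ι w
  ⊛-trit≼ w 1ₜ 0≼w = ≼-reflexive (pointwise λ k → ℚₚ.*-identityʳ (seq w k))
  ⊛-trit≼ w 0ₜ  0≼w = drop-⊕ 0≼w (⊛-trit-≢1 w 0ₜ 0≼w λ ())
  ⊛-trit≼ w -1ₜ 0≼w = drop-⊕ 0≼w (⊛-trit-≢1 w -1ₜ 0≼w λ ())

  sum-mono-gap : ∀ {k} (f g : Vector Seq k) d j → (∀ i → f i ≼ g i) → f j ⊕ d ≼ g j → sum f ⊕ d ≼ sum g
  sum-mono-gap {suc k} f g d zero    f≼g gap = ≼-trans
    (≼-reflexive (pointwise λ i → lemma (at (f zero) i) (at (sum (f ∘ suc)) i) (at d i)))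
    (⊕-mono-≼ gap (sum-mono-≼ (f≼g ∘ suc)))
    where
    open +-*-Solver
    lemma : ∀ a s d → a ℚ.+ s ℚ.+ d ≡ a ℚ.+ d ℚ.+ s
    lemma = solve 3 (λ a s d → a :+ s :+ d := a :+ d :+ s) refl
  sum-mono-gap {suc k} f g d (suc j) f≼g gap = ≼-trans
    (≼-reflexive (pointwise λ i → ℚₚ.+-assoc (at (f zero) i) (at (sum (f ∘ suc)) i) (at d i)))
    (⊕-mono-≼ (f≼g zero) (sum-mono-gap (f ∘ suc) (g ∘ suc) d j (f≼g ∘ suc) gap))

  ι-combination : ∀ {k} (w p : Vector ℝ k) → ι (Defs.sum (λ j → w j Defs.* p j)) ≐ sum (λ j → w j ⊛ ι (p j))
  ι-combination {zero}  w p = pointwise λ _ → refl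
  ι-combination {suc k} w p = pointwise λ i →
    cong (seq (w zero) i ℚ.* seq (p zero) i ℚ.+_) (eq-at (ι-combination (w ∘ suc) (p ∘ suc)) i)

  sat-separates : ∀ (A : Vec Bool n) x y → sat A x ≡ true → sat A y ≡ false →
    ∃[ c ] lookup x c ≡ 1ₜ × lookup y c ≢ 1ₜ
  sat-separates [] [] [] _ ()
  sat-separates (false ∷ A) (_  ∷ x) (_   ∷ y) satx ¬saty =
    let c , xc , yc = sat-separates A x y satx ¬saty in suc c , xc , yc
  sat-separates (true  ∷ A) (1ₜ ∷ x) (1ₜ  ∷ y) satx ¬saty =
    let c , xc , yc = sat-separates A x y satx ¬saty in suc c , xc , yc
  sat-separates (true  ∷ A) (1ₜ ∷ x) (0ₜ  ∷ y) satx ¬saty = zero , refl , λ ()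
  sat-separates (true  ∷ A) (1ₜ ∷ x) (-1ₜ ∷ y) satx ¬saty = zero , refl , λ ()

  excluding-term : ∀ (As : Vec (Vec Bool n) N) b x → concept As b x ≡ false →
    ∃[ A ] sat A x ≡ true × (∀ y → concept As b y ≡ true → sat A y ≡ false)
  excluding-term [] [] x ()
  excluding-term (A ∷ As) (true ∷ b) x eq with sat A x in satx
  ... | true = A , satx , λ y → misses y
    where
    misses : ∀ y → concept (A ∷ As) (true ∷ b) y ≡ true → sat A y ≡ false
    misses y eq with sat A y
    ... | false = refl
  ... | false with excluding-term As b x eq
  ...   | A′ , satx′ , misses′ = A′ , satx′ , misses
    where
    misses : ∀ y → concept (A ∷ As) (true ∷ b) y ≡ true → sat A′ y ≡ false
    misses y eq with sat A y
    ... | false = misses′ y eq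
  excluding-term (A ∷ As) (false ∷ b) x eq = excluding-term As b x eq

  -- If x = Σ w_j p_j satisfies a term that every p_j violates, then each p_j has a
  -- coordinate below x's maximal value 1, which forces w_j = 0.
  concept-convex : ∀ (As : Vec (Vec Bool n) N) b → Convex (concept As b)
  concept-convex {n} As b x = mk⇔ in-hull from-hull
    where
    S = concept As b
    in-hull : T (S x) → embed x ∈ Conv (image S)
    in-hull Sx = 1 , (λ _ → Defs.1ℝ) , (λ _ → embed x) ,
      record { nonNegative = λ _ → unwrap 0≼1 ; total = unwrap total≤ , unwrap total≥ } ,
      (λ _ → x , Sx , λ i → unwrap (≼-refl {ι (embed x i)}) , unwrap (≼-refl {ι (embed x i)})) ,
      λ i → unwrap (≼-reflexive (combination i)) , unwrap (≼-reflexive (≐-sym (combination i)))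
      where
      total≤ : 𝟙 ⊕ 𝟘 ≼ 𝟙
      total≤ = ≼-reflexive (⊕-identityʳ 𝟙)
      total≥ : 𝟙 ≼ 𝟙 ⊕ 𝟘
      total≥ = ≼-reflexive (≐-sym (⊕-identityʳ 𝟙))
      combination : ∀ i → ι (embed x i) ≐ Defs.1ℝ ⊛ ι (embed x i) ⊕ 𝟘
      combination i = pointwise λ k → sym (trans (ℚₚ.+-identityʳ _) (ℚₚ.*-identityˡ (seq (embed x i) k)))

    outside : S x ≡ false → ¬ (embed x ∈ Conv (image S))
    outside ¬Sx (k , w , p , weighting , p∈S , x≈) with excluding-term As b x ¬Sx
    ... | A , satx , misses = 1⋠0 (≼-trans (wrap (proj₂ total)) (≼-trans (≼-reflexive (ι-sum w))
          (≼-trans (sum-mono-≼ w≼0) (≼-reflexive (sum-replicate-zero k)))))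
      where
      open IsWeighting weighting
      y : Fin k → Point n
      y j = proj₁ (p∈S j)
      0≼w : ∀ j → 𝟘 ≼ ι (w j)
      0≼w j = wrap (nonNegative j)
      wp : Fin n → Vector Seq k
      wp c j = w j ⊛ ι (p j c)
      wp≼ : ∀ c j → wp c j ≼ w j ⊛ ι (tritℝ (lookup (y j) c))
      wp≼ c j = ⊛-cong-≼ (w j) (wrap (proj₁ (proj₂ (proj₂ (p∈S j)) c))) (wrap (proj₂ (proj₂ (proj₂ (p∈S j)) c)))
      w≼0 : ∀ j → ι (w j) ≼ 𝟘
      w≼0 j with sat-separates A x (y j) satx (misses (y j) (T⇒≡ (proj₁ (proj₂ (p∈S j)))))
        where
        T⇒≡ : ∀ {b} → T b → b ≡ true
        T⇒≡ {true} _ = refl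
      -- At the separating coordinate c, 1 = x_c = Σ w_i p_i(c) ≤ Σ w_i - w_j = 1 - w_j, with w_j
      -- moved to the left side.
      ... | c , xc≡1 , yc≢1 = ⊕-cancelˡ-≼ 𝟙 (begin
        𝟙 ⊕ ι (w j)                ≲⟨ ⊕-mono-≼ 1≼ ≼-refl ⟩
        sum (wp c) ⊕ ι (w j)       ≲⟨ sum-mono-gap (wp c) (ι ∘ w) (ι (w j)) j
                                        (λ i → ≼-trans (wp≼ c i) (⊛-trit≼ (w i) (lookup (y i) c) (0≼w i)))
                                        (≼-trans (⊕-mono-≼ (wp≼ c j) ≼-refl) (⊛-trit-≢1 (w j) _ (0≼w j) yc≢1)) ⟩
        sum (ι ∘ w)                ≈⟨ ι-sum w ⟨
        ι (Defs.sum w)             ≲⟨ wrap (proj₁ total) ⟩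
        𝟙                          ≈⟨ ⊕-identityʳ 𝟙 ⟨
        𝟙 ⊕ 𝟘                      ∎)
        where
        open ≼-Reasoning
        1≼ : 𝟙 ≼ sum (wp c)
        1≼ = begin
          𝟙                                              ≈⟨ pointwise (λ i → cong (λ t → seq (tritℝ t) i) xc≡1) ⟨
          ι (embed x c)                                  ≲⟨ wrap (proj₁ (x≈ c)) ⟩
          ι (Defs.sum (λ j → w j Defs.* p j c))          ≈⟨ ι-combination w (λ j → p j c) ⟩
          sum (wp c)                                     ∎

    from-hull : embed x ∈ Conv (image S) → T (S x)
    from-hull x∈ with S x in eq
    ... | true  = _
    ... | false = contradiction x∈ (outside eq)

-- Averaging the learner's success over all concepts

module Learning where
  open import Data.Bool.Base using (Bool; true; false; not; _∧_; _xor_; T)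
  open import Data.Fin.Base using (Fin)
  open import Data.Fin.Subset using (∣_∣)
  import Data.Integer.Base as ℤ
  open import Data.List.Base as List using (List; []; _∷_; length; filterᵇ)
  open import Data.Nat.Base
  open import Data.Nat.DivMod using (_/_; m/n*n≤m; m*n/n≡m; /-monoˡ-≤)
  open import Data.Nat.Properties
  open import Data.Nat.Tactic.RingSolver using (solve-∀)
  open import Data.Product.Base using (∃-syntax; _×_; _,_; proj₁; proj₂)
  import Data.Rational.Base as ℚ
  open import Data.Vec.Base using (Vec; lookup; updateAt)
  open import Defs using (ℝ; Point; Subset; points; vectors; dist; prob; Learner; Learns; label; outputProb)
  import Defs
  open import Function.Base using (_∘_)
  open import Relation.Binary.PropositionalEquality
  open Counting
  open Family using (unique)
  open Concepts
  open Reals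
  open Convexity using (concept-convex)

  bits : ∀ N → List (Vec Bool N)
  bits = vectors (false ∷ true ∷ [])

  length-bits : ∀ N → length (bits N) ≡ 2 ^ N
  length-bits = length-vectors _

  -- Since 12/243 = 4/81 is below the fraction 5/81 of uniquely covered points, a hypothesis this
  -- close to the concept errs on at most a twelfth as many points as are uniquely covered.
  ε₀ : ℝ
  ε₀ = Defs.fromℚ (ℤ.+ 1 ℚ./ 243)

  module _ {n N m w} (As : Vec (Vec Bool n) N) (∣As∣ : ∀ i → ∣ lookup As i ∣ ≡ w)
           {ε} (ε≤ε₀ : ε Defs.≤ ε₀) (L : Learner n m) (learns : Learns ε L) where

    private
      M D B W r e : ℕ
      M = 3 ^ n
      D = M ^ m
      B = 2 ^ N
      W = 3 ^ w
      r = ∑ℕ.∑ (points n) (⟦_⟧ ∘ unique As)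
      e = M / 243

      samples : List (Vec (Point n) m)
      samples = vectors (points n) m

      differences : Vec Bool N → Subset n → ℕ
      differences b U = ∑ℕ.∑ (points n) (λ y → ⟦ concept As b y xor U y ⟧)

      -- The decidable event to which `Learns` is applied. It contains the event of distance below ε
      -- because ε ≤ 1/243 and the number of differences is an integer, so rounding `M / 243` down
      -- costs nothing.
      close : Vec Bool N → Subset n → Bool
      close b U = differences b U ≤ᵇ e

      agree : Vec Bool N → Point n → Subset n → Bool
      agree b y U = unique As y ∧ not (concept As b y xor U y)

      p : Vec Bool N → Vec (Point n) m → Seq
      p b xs = probSeq (L (label (concept As b) xs)) (close b)

      h : Point n → Vec (Point n) m → Vec Bool N → Seq
      h y xs b = probSeq (L (label (concept As b) xs)) (agree b y)

    dist<ε⇒close : ∀ b U → Defs.fromℚ (dist (concept As b) U) Defs.< ε → T (close b U)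
    dist<ε⇒close b U d<ε = ≤⇒≤ᵇ (≤-trans (≤-reflexive (sym (m*n/n≡m (differences b U) 243))) (/-monoˡ-≤ 243 (begin
      differences b U * 243
        ≡⟨ cong (_* 243) (length-filterᵇ (λ y → concept As b y xor U y) (points n)) ⟨
      length (filterᵇ (λ y → concept As b y xor U y) (points n)) * 243
        ≤⟨ /≤/⇒*≤* (length (filterᵇ (λ y → concept As b y xor U y) (points n))) M 1 243 {{m^n≢0 3 n}}
             (fromℚ<≤⇒≤ {p = dist (concept As b) U} ε d<ε ε≤ε₀) ⟩
      1 * M
        ≡⟨ *-identityˡ M ⟩
      M ∎)))
      where open ≤-Reasoning

    success : ∀ b → (2 * D) · 𝟙 ≼ 3 · ∑ samples (p b)
    success b = 2/3≼x/D⇒2D≼3x D {{m^n≢0 M m {{m^n≢0 3 n}}}} (∑ samples (p b))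
      (ι (outputProb L (concept As b) (close b)))
      (λ k → cong ((ℤ.+ 1 ℚ./ D) {{m^n≢0 M m {{m^n≢0 3 n}}}} ℚ.*_) (eq-at total k))
      (wrap (learns (concept As b) (concept-convex As b) (close b) (dist<ε⇒close b)))
      where
      total : ι (List.foldr Defs._+_ Defs.0ℝ
        (List.map (λ xs → prob (L (label (concept As b) xs)) (close b)) samples)) ≐ ∑ samples (p b)
      total = ≐-trans (ι-∑ samples (λ xs → prob (L (label (concept As b) xs)) (close b)))
        (∑-cong samples (λ xs → ι-prob (L (label (concept As b) xs)) (close b)))

    close⇒agree : ∀ b U → close b U ≡ true → r ≤ ∑ℕ.∑ (points n) (λ y → ⟦ agree b y U ⟧) + e
    close⇒agree b U close≡ = begin
      r
        ≤⟨ ∑-mono (points n) (λ y → split (unique As y) (concept As b y xor U y)) ⟩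
      ∑ℕ.∑ (points n) (λ y → ⟦ agree b y U ⟧ + ⟦ concept As b y xor U y ⟧)
        ≡⟨ ∑ℕ.∑-distrib-+ (points n) (λ y → ⟦ agree b y U ⟧) _ ⟩
      ∑ℕ.∑ (points n) (λ y → ⟦ agree b y U ⟧) + differences b U
        ≤⟨ +-monoʳ-≤ (∑ℕ.∑ (points n) (λ y → ⟦ agree b y U ⟧)) (≤ᵇ⇒≤ _ e (subst T (sym close≡) _)) ⟩
      ∑ℕ.∑ (points n) (λ y → ⟦ agree b y U ⟧) + e ∎
      where
      open ≤-Reasoning
      split : ∀ u d → ⟦ u ⟧ ≤ ⟦ u ∧ not d ⟧ + ⟦ d ⟧
      split false d     = z≤n
      split true  false = s≤s z≤n
      split true  true  = s≤s z≤n

    success≼agree : ∀ b xs → r · p b xs ≼ ∑ (points n) (λ y → h y xs b) ⊕ e · 𝟙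
    success≼agree b xs = ×-prob≼ (L (label (concept As b) xs)) (close b) (agree b) (points n) r e (close⇒agree b)

    -- A hypothesis built without seeing the term i agrees at y with exactly one of
    -- two concepts that differ in the presence of this term.
    agree-unseen : ∀ y i → unique As y ≡ true → (∀ b → concept As (updateAt b i not) y ≡ not (concept As b y)) →
      ∀ xs → seen (lookup As i) xs ≡ false → 2 · ∑ (bits N) (h y xs) ≼ B · 𝟙
    agree-unseen y i uniq flips xs unseen = begin
      ∑ (bits N) (h y xs) ⊕ (∑ (bits N) (h y xs) ⊕ 𝟘)
        ≈⟨ ⊕-congˡ (⊕-identityʳ _) ⟩
      ∑ (bits N) (h y xs) ⊕ ∑ (bits N) (h y xs)
        ≈⟨ ⊕-congˡ (∑-flip i (h y xs)) ⟩
      ∑ (bits N) (h y xs) ⊕ ∑ (bits N) (λ b → h y xs (updateAt b i not))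
        ≈⟨ ∑-distrib-+ (bits N) (h y xs) _ ⟨
      ∑ (bits N) (λ b → h y xs b ⊕ h y xs (updateAt b i not))
        ≲⟨ ∑-mono-≼ (bits N) pair≼1 ⟩
      ∑ (bits N) (λ _ → 𝟙)
        ≈⟨ ∑-const (bits N) 𝟙 ⟩
      length (bits N) · 𝟙
        ≡⟨ cong (_· 𝟙) (length-bits N) ⟩
      B · 𝟙 ∎
      where
      open ≼-Reasoning
      pair≼1 : ∀ b → h y xs b ⊕ h y xs (updateAt b i not) ≼ 𝟙
      pair≼1 b rewrite label-flip As b i xs unseen =
        prob-complement (L (label (concept As b) xs)) (agree b y) (agree (updateAt b i not) y) complement
        where
        complement : ∀ U → agree (updateAt b i not) y U ≡ not (agree b y U)
        complement U rewrite uniq | flips b with concept As b y | U y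
        ... | false | false = refl
        ... | false | true  = refl
        ... | true  | false = refl
        ... | true  | true  = refl

    agree-seen : ∀ y xs → 2 · ∑ (bits N) (h y xs) ≼ (B + B) · 𝟙
    agree-seen y xs = begin
      2 · ∑ (bits N) (h y xs)
        ≲⟨ ×-monoʳ-≼ 2 (∑-mono-≼ (bits N) (λ b → prob≼1 (L (label (concept As b) xs)) (agree b y))) ⟩
      2 · ∑ (bits N) (λ _ → 𝟙)
        ≈⟨ ×-congʳ 2 (∑-const (bits N) 𝟙) ⟩
      2 · length (bits N) · 𝟙
        ≈⟨ ×-assocˡ 𝟙 2 (length (bits N)) ⟩
      (2 * length (bits N)) · 𝟙
        ≡⟨ cong (_· 𝟙) (trans (cong (2 *_) (length-bits N)) (cong (B +_) (+-identityʳ B))) ⟩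
      (B + B) · 𝟙 ∎
      where open ≼-Reasoning

    agree-absent : ∀ y → unique As y ≡ false → ∀ xs b → h y xs b ≼ 𝟘
    agree-absent y ¬uniq xs b = begin
      h y xs b            ≈⟨ ×-homo-1 (h y xs b) ⟨
      -- With no events on the right and e = 0, the counting bound says that an impossible event has
      -- probability at most 0.
      1 · h y xs b        ≲⟨ ×-prob≼ (L (label (concept As b) xs)) (agree b y) (agree b) [] 1 0 impossible ⟩
      𝟘 ⊕ 𝟘               ≈⟨ ⊕-identityˡ 𝟘 ⟩
      𝟘                   ∎
      where
      open ≼-Reasoning
      impossible : ∀ U → agree b y U ≡ true → 1 ≤ 0
      impossible U eq rewrite ¬uniq with () ← eq

    -- Here s counts the samples in which the only term satisfied by y is seen. Summed over the
    -- concepts, twice the agreement is at most B for an unseen sample and 2B for a seen one. If y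
    -- is not uniquely covered, s = 0, so that the bounds can be added up over all points. The
    -- separate u permits the case split.
    agree-total : ∀ y u → unique As y ≡ u → ∃[ s ] s * W ≤ ⟦ u ⟧ * (m * D) ×
      2 · ∑ samples (λ xs → ∑ (bits N) (h y xs)) ≼ (⟦ u ⟧ * (D * B) + B * s) · 𝟙
    agree-total y false uniq = 0 , z≤n , (begin
      2 · ∑ samples (λ xs → ∑ (bits N) (h y xs))
        ≲⟨ ×-monoʳ-≼ 2 (∑-mono-≼ samples (λ xs → ∑-mono-≼ (bits N) (agree-absent y uniq xs))) ⟩
      2 · ∑ samples (λ xs → ∑ (bits N) (λ _ → 𝟘))
        ≈⟨ ×-congʳ 2 (≐-trans (∑-cong samples (λ _ → ∑-zero (bits N))) (∑-zero samples)) ⟩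
      2 · 𝟘
        ≲⟨ ≼-reflexive (≐-trans (⊕-identityˡ _) (⊕-identityˡ 𝟘)) ⟩
      𝟘
        ≲⟨ ×-nonNeg (B * 0) 0≼1 ⟩
      (B * 0) · 𝟙 ∎)
      where open ≼-Reasoning
    agree-total y true uniq with unique⇒flips As y uniq
    ... | i , flips = s , s*W≤ , (begin
      2 · ∑ samples (λ xs → ∑ (bits N) (h y xs))
        ≈⟨ ∑-× 2 samples (λ xs → ∑ (bits N) (h y xs)) ⟩
      ∑ samples (λ xs → 2 · ∑ (bits N) (h y xs))
        ≲⟨ ∑-mono-≼ samples each ⟩
      ∑ samples (λ xs → (B + B * ⟦ seen (lookup As i) xs ⟧) · 𝟙)
        ≈⟨ ∑-×ˡ samples (λ xs → B + B * ⟦ seen (lookup As i) xs ⟧) 𝟙 ⟩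
      ∑ℕ.∑ samples (λ xs → B + B * ⟦ seen (lookup As i) xs ⟧) · 𝟙
        ≡⟨ cong (_· 𝟙) (trans (∑ℕ.∑-distrib-+ samples (λ _ → B) _)
             (cong₂ _+_ (trans (∑-replicate samples B)
               (trans (cong (_* B) (length-samples n m)) (sym (*-identityˡ (D * B)))))
                        (∑-*ˡ B samples (⟦_⟧ ∘ seen (lookup As i))))) ⟩
      (1 * (D * B) + B * s) · 𝟙 ∎)
      where
      open ≼-Reasoning
      s = ∑ℕ.∑ samples (⟦_⟧ ∘ seen (lookup As i))
      s*W≤ : s * W ≤ 1 * (m * D)
      s*W≤ = subst₂ _≤_ (cong (λ k → s * 3 ^ k) (∣As∣ i)) (sym (*-identityˡ (m * D))) (∣seen∣ m (lookup As i))
      each : ∀ xs → 2 · ∑ (bits N) (h y xs) ≼ (B + B * ⟦ seen (lookup As i) xs ⟧) · 𝟙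
      each xs with seen (lookup As i) xs in seen≡
      ... | false = ≼-trans (agree-unseen y i uniq flips xs seen≡) (×-monoˡ-≼ 0≼1 (m≤m+n B _))
      ... | true  = ≼-trans (agree-seen y xs) (≼-reflexive (×-congˡ (cong (B +_) (sym (*-identityʳ B)))))

    private
      s : Point n → ℕ
      s y = proj₁ (agree-total y (unique As y) refl)
      X H : Seq
      X = ∑ samples (λ xs → ∑ (bits N) (λ b → p b xs))
      H = ∑ (points n) (λ y → ∑ samples (λ xs → ∑ (bits N) (h y xs)))
      S : ℕ
      S = ∑ℕ.∑ (points n) s

    S*W≤ : S * W ≤ r * (m * D)
    S*W≤ = begin
      S * W                                              ≡⟨ ∑-*ʳ (points n) s W ⟩
      ∑ℕ.∑ (points n) (λ y → s y * W)
        ≤⟨ ∑-mono (points n) (λ y → proj₁ (proj₂ (agree-total y (unique As y) refl))) ⟩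
      ∑ℕ.∑ (points n) (λ y → ⟦ unique As y ⟧ * (m * D))  ≡⟨ ∑-*ʳ (points n) (⟦_⟧ ∘ unique As) (m * D) ⟨
      r * (m * D)                                        ∎
      where open ≤-Reasoning

    2H≼ : 2 · H ≼ (r * (D * B) + B * S) · 𝟙
    2H≼ = begin
      2 · H
        ≈⟨ ∑-× 2 (points n) (λ y → ∑ samples (λ xs → ∑ (bits N) (h y xs))) ⟩
      ∑ (points n) (λ y → 2 · ∑ samples (λ xs → ∑ (bits N) (h y xs)))
        ≲⟨ ∑-mono-≼ (points n) (λ y → proj₂ (proj₂ (agree-total y (unique As y) refl))) ⟩
      ∑ (points n) (λ y → (⟦ unique As y ⟧ * (D * B) + B * s y) · 𝟙)
        ≈⟨ ∑-×ˡ (points n) (λ y → ⟦ unique As y ⟧ * (D * B) + B * s y) 𝟙 ⟩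
      ∑ℕ.∑ (points n) (λ y → ⟦ unique As y ⟧ * (D * B) + B * s y) · 𝟙
        ≡⟨ cong (_· 𝟙) (trans (∑ℕ.∑-distrib-+ (points n) (λ y → ⟦ unique As y ⟧ * (D * B)) _)
             (cong₂ _+_ (sym (∑-*ʳ (points n) (⟦_⟧ ∘ unique As) (D * B))) (∑-*ˡ B (points n) s))) ⟩
      (r * (D * B) + B * S) · 𝟙 ∎
      where open ≼-Reasoning

    2BD≼3X : (B * (2 * D)) · 𝟙 ≼ 3 · X
    2BD≼3X = begin
      (B * (2 * D)) · 𝟙
        ≡⟨ cong (λ k → (k * (2 * D)) · 𝟙) (length-bits N) ⟨
      (length (bits N) * (2 * D)) · 𝟙
        ≈⟨ ×-assocˡ 𝟙 (length (bits N)) (2 * D) ⟨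
      length (bits N) · (2 * D) · 𝟙
        ≈⟨ ∑-const (bits N) _ ⟨
      ∑ (bits N) (λ _ → (2 * D) · 𝟙)
        ≲⟨ ∑-mono-≼ (bits N) success ⟩
      ∑ (bits N) (λ b → 3 · ∑ samples (p b))
        ≈⟨ ∑-× 3 (bits N) (λ b → ∑ samples (p b)) ⟨
      3 · ∑ (bits N) (λ b → ∑ samples (p b))
        ≈⟨ ×-congʳ 3 (∑-comm (bits N) samples p) ⟩
      3 · X ∎
      where open ≼-Reasoning

    rX≼H : r · X ≼ H ⊕ (D * (B * e)) · 𝟙
    rX≼H = begin
      r · X
        ≈⟨ ∑-× r samples (λ xs → ∑ (bits N) (λ b → p b xs)) ⟩
      ∑ samples (λ xs → r · ∑ (bits N) (λ b → p b xs))
        ≈⟨ ∑-cong samples (λ xs → ∑-× r (bits N) (λ b → p b xs)) ⟩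
      ∑ samples (λ xs → ∑ (bits N) (λ b → r · p b xs))
        ≲⟨ ∑-mono-≼ samples (λ xs → ∑-mono-≼ (bits N) (λ b → success≼agree b xs)) ⟩
      ∑ samples (λ xs → ∑ (bits N) (λ b → ∑ (points n) (λ y → h y xs b) ⊕ e · 𝟙))
        ≈⟨ ∑-cong samples (λ xs → ≐-trans
             (∑-distrib-+ (bits N) (λ b → ∑ (points n) (λ y → h y xs b)) (λ _ → e · 𝟙))
             (⊕-cong (∑-comm (bits N) (points n) (λ b y → h y xs b))
               (≐-trans (∑-const (bits N) (e · 𝟙)) (≐-trans (×-congˡ (length-bits N)) (×-assocˡ 𝟙 B e))))) ⟩
      ∑ samples (λ xs → ∑ (points n) (λ y → ∑ (bits N) (h y xs)) ⊕ (B * e) · 𝟙)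
        ≈⟨ ∑-distrib-+ samples (λ xs → ∑ (points n) (λ y → ∑ (bits N) (h y xs))) (λ _ → (B * e) · 𝟙) ⟩
      ∑ samples (λ xs → ∑ (points n) (λ y → ∑ (bits N) (h y xs))) ⊕ ∑ samples (λ _ → (B * e) · 𝟙)
        ≈⟨ ⊕-cong (∑-comm samples (points n) (λ xs y → ∑ (bits N) (h y xs)))
             (≐-trans (∑-const samples ((B * e) · 𝟙))
               (≐-trans (×-congˡ (length-samples n m)) (×-assocˡ 𝟙 D (B * e)))) ⟩
      H ⊕ (D * (B * e)) · 𝟙 ∎
      where open ≼-Reasoning

    -- Divided by 6BD this reads 2r/3 ≤ r/2 + S/(2D) + e. Success forces agreement on all but e of
    -- the r uniquely covered points, while guessing gives r/2 and the seen terms add at most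
    -- S/(2D).
    counts : 2 * r * (B * (2 * D)) ≤ 3 * (r * (D * B) + B * S) + 6 * (D * (B * e))
    counts = ×1-cancel _ _ (begin
      (2 * r * (B * (2 * D))) · 𝟙
        ≈⟨ ×-assocˡ 𝟙 (2 * r) (B * (2 * D)) ⟨
      (2 * r) · (B * (2 * D)) · 𝟙
        ≲⟨ ×-monoʳ-≼ (2 * r) 2BD≼3X ⟩
      (2 * r) · 3 · X
        ≈⟨ ×-assocˡ X (2 * r) 3 ⟩
      (2 * r * 3) · X
        ≡⟨ cong (_· X) (lemma r) ⟩
      (6 * r) · X
        ≈⟨ ×-assocˡ X 6 r ⟨
      6 · r · X
        ≲⟨ ×-monoʳ-≼ 6 rX≼H ⟩
      6 · (H ⊕ (D * (B * e)) · 𝟙)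
        ≈⟨ ×-distrib-+ H _ 6 ⟩
      6 · H ⊕ 6 · (D * (B * e)) · 𝟙
        ≈⟨ ⊕-cong (≐-sym (×-assocˡ H 3 2)) (×-assocˡ 𝟙 6 (D * (B * e))) ⟩
      3 · 2 · H ⊕ (6 * (D * (B * e))) · 𝟙
        ≲⟨ ⊕-mono-≼ (×-monoʳ-≼ 3 2H≼) ≼-refl ⟩
      3 · (r * (D * B) + B * S) · 𝟙 ⊕ (6 * (D * (B * e))) · 𝟙
        ≈⟨ ⊕-congʳ (×-assocˡ 𝟙 3 (r * (D * B) + B * S)) ⟩
      (3 * (r * (D * B) + B * S)) · 𝟙 ⊕ (6 * (D * (B * e))) · 𝟙
        ≈⟨ ×-homo-+ 𝟙 (3 * (r * (D * B) + B * S)) (6 * (D * (B * e))) ⟨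
      (3 * (r * (D * B) + B * S) + 6 * (D * (B * e))) · 𝟙 ∎)
      where
      open ≼-Reasoning
      lemma : ∀ r → 2 * r * 3 ≡ 6 * r
      lemma = solve-∀

    -- From r/6 ≤ S/(2D) + e, the bounds S/D ≤ rm/W and e ≤ r/12 leave r/12 ≤ rm/(2W). The part of e
    -- is cancelled as one of two copies of `r * D * W`.
    3^w≤6m : 5 * M ≤ 81 * r → W ≤ 6 * m
    3^w≤6m large = *-cancelˡ-≤ (r * D) {{m*n≢0 r D {{r≢0}} {{D≢0}}}} (+-cancelʳ-≤ (r * D * W) _ _ (begin
      r * D * W + r * D * W
        ≡⟨ lemma₁ r D W ⟩
      2 * (r * D) * W
        ≤⟨ *-monoˡ-≤ W (*-monoʳ-≤ 2 rD≤) ⟩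
      2 * (3 * S + 6 * (D * e)) * W
        ≡⟨ lemma₂ S W D e ⟩
      6 * (S * W) + 12 * e * (D * W)
        ≤⟨ +-mono-≤ (*-monoʳ-≤ 6 S*W≤) (*-monoˡ-≤ (D * W) 12e≤r) ⟩
      6 * (r * (m * D)) + r * (D * W)
        ≡⟨ lemma₃ r m D W ⟩
      r * D * (6 * m) + r * D * W ∎))
      where
      open ≤-Reasoning
      D≢0 : NonZero D
      D≢0 = m^n≢0 M m {{m^n≢0 3 n}}
      r≢0 : NonZero r
      r≢0 = ≢-nonZero λ r≡0 → <⇒≱ (m^n>0 3 n) (*-cancelˡ-≤ 5 (≤-trans large (≤-reflexive (cong (81 *_) r≡0))))
      rD≤ : r * D ≤ 3 * S + 6 * (D * e)
      rD≤ = *-cancelˡ-≤ B {{m^n≢0 2 N}} (+-cancelˡ-≤ (3 * (r * (D * B))) _ _ (begin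
        3 * (r * (D * B)) + B * (r * D)                     ≡⟨ lemma₄ r D B ⟩
        2 * r * (B * (2 * D))                               ≤⟨ counts ⟩
        3 * (r * (D * B) + B * S) + 6 * (D * (B * e))       ≡⟨ lemma₅ r D B S e ⟩
        3 * (r * (D * B)) + B * (3 * S + 6 * (D * e))       ∎))
        where
        lemma₄ : ∀ r D B → 3 * (r * (D * B)) + B * (r * D) ≡ 2 * r * (B * (2 * D))
        lemma₄ = solve-∀
        lemma₅ : ∀ r D B S e → 3 * (r * (D * B) + B * S) + 6 * (D * (B * e)) ≡
          3 * (r * (D * B)) + B * (3 * S + 6 * (D * e))
        lemma₅ = solve-∀
      12e≤r : 12 * e ≤ r
      12e≤r = *-cancelˡ-≤ 81 (begin
        81 * (12 * e)      ≡⟨ lemma₆ e ⟩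
        4 * (e * 243)      ≤⟨ *-monoʳ-≤ 4 (m/n*n≤m M 243) ⟩
        4 * M              ≤⟨ *-monoˡ-≤ M (n≤1+n 4) ⟩
        5 * M              ≤⟨ large ⟩
        81 * r             ∎)
        where
        lemma₆ : ∀ e → 81 * (12 * e) ≡ 4 * (e * 243)
        lemma₆ = solve-∀
      lemma₁ : ∀ r D W → r * D * W + r * D * W ≡ 2 * (r * D) * W
      lemma₁ = solve-∀
      lemma₂ : ∀ S W D e → 2 * (3 * S + 6 * (D * e)) * W ≡ 6 * (S * W) + 12 * e * (D * W)
      lemma₂ = solve-∀
      lemma₃ : ∀ r m D W → 6 * (r * (m * D)) + r * (D * W) ≡ r * D * (6 * m) + r * D * W
      lemma₃ = solve-∀

-- From the bound in w to the bound in √n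

module SampleBound where
  open import Data.Nat.Base
  open import Data.Nat.Properties
  open import Data.Nat.Tactic.RingSolver using (solve-∀)
  open import Data.Product.Base using (∃-syntax; _×_; _,_)
  open import Defs using (Learner; Learns)
  import Defs
  open import Relation.Binary.PropositionalEquality
  open import Relation.Nullary using (yes; no; contradiction)
  open Family using (dim≡; greedy; ∣unique∣-large)
  open Learning using (ε₀; 3^w≤6m)

  ∃-4w²≤n<4[w+1]² : ∀ n → ∃[ w ] (w * (4 * w) ≤ n × n < suc w * (4 * suc w))
  ∃-4w²≤n<4[w+1]² zero = 0 , z≤n , s≤s z≤n
  ∃-4w²≤n<4[w+1]² (suc n) with ∃-4w²≤n<4[w+1]² n
  ... | w , lo , hi with suc n <? suc w * (4 * suc w)
  ...   | yes hi′ = w , m≤n⇒m≤1+n lo , hi′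
  ...   | no  ≮hi = suc w , ≤-reflexive (sym n≡) , subst (_< suc (suc w) * (4 * suc (suc w))) (sym n≡)
          (*-mono-< (n<1+n (suc w)) (*-monoʳ-< 4 (n<1+n (suc w))))
    where
    n≡ : suc n ≡ suc w * (4 * suc w)
    n≡ = ≤-antisym hi (≮⇒≥ ≮hi)

  m*m≤n*n⇒m≤n : ∀ m n → m * m ≤ n * n → m ≤ n
  m*m≤n*n⇒m≤n m n h with m ≤? n
  ... | yes m≤n = m≤n
  ... | no  m≰n = contradiction h (<⇒≱ (*-mono-< (≰⇒> m≰n) (≰⇒> m≰n)))

  3^v≤m : ∀ {n m ε} v → (2 + v) * (4 * (2 + v)) ≤ n → ε Defs.≤ ε₀ →
    ∀ (L : Learner n m) → Learns ε L → 3 ^ v ≤ m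
  3^v≤m {n} {m} {ε} v 4w²≤n ε≤ε₀ L learns with m≤n⇒∃[o]m+o≡n 4w²≤n
  -- The remainder s is the number of coordinates outside the blocks; matching on the equation puts
  -- `dim` in the place of n.
  ... | s , 4w²+s≡n with trans (dim≡ (4 * (2 + v)) (2 + v) s) 4w²+s≡n
  ...   | refl = let As , ∣As∣ , overlaps≤ = greedy (2 + v) s (3 ^ v) in
    *-cancelˡ-≤ 9 (begin
      9 * 3 ^ v      ≡⟨ *-assoc 3 3 (3 ^ v) ⟩
      3 ^ (2 + v)    ≤⟨ 3^w≤6m As ∣As∣ {ε} ε≤ε₀ L learns (∣unique∣-large v As ∣As∣ overlaps≤) ⟩
      -- Weakening 6 to 9 = 3² cancels the two extra coordinates of each term.
      6 * m          ≤⟨ *-monoˡ-≤ m (m≤m+n 6 3) ⟩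
      9 * m          ∎)
    where open ≤-Reasoning

  -- With w = 2 + v maximal such that 4w² ≤ n, √n < 2(3 + v) ≤ 8v as soon as v ≥ 1. So a/b ≤ √n/8
  -- gives a ≤ vb, and 3^v ≤ m is raised to the power b. This fixes the constant 1/8.
  3^a≤m^b : ∀ {n m ε} a b → 36 ≤ n → ε Defs.≤ ε₀ → ∀ (L : Learner n m) → Learns ε L →
    a * a * 64 ≤ n * (b * b) → 3 ^ a ≤ m ^ b
  3^a≤m^b {n} {m} {ε} a b 36≤n ε≤ε₀ L learns 64a²≤nb² with ∃-4w²≤n<4[w+1]² n
  -- The threshold 36 = 4·3² excludes w < 3, so that v = w - 2 is positive.
  ... | 0 , lo , hi = contradiction (≤-trans hi (m≤m+n 4 32)) (≤⇒≯ 36≤n)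
  ... | 1 , lo , hi = contradiction (≤-trans hi (m≤m+n 16 20)) (≤⇒≯ 36≤n)
  ... | 2 , lo , hi = contradiction hi (≤⇒≯ 36≤n)
  ... | suc (suc v@(suc u)) , lo , hi = begin
    3 ^ a           ≤⟨ ^-monoʳ-≤ 3 a≤vb ⟩
    3 ^ (v * b)     ≡⟨ ^-*-assoc 3 v b ⟨
    (3 ^ v) ^ b     ≤⟨ ^-monoˡ-≤ b (3^v≤m {ε = ε} v lo ε≤ε₀ L learns) ⟩
    m ^ b           ∎
    where
    open ≤-Reasoning
    a≤vb : a ≤ v * b
    a≤vb = *-cancelˡ-≤ 8 (m*m≤n*n⇒m≤n (8 * a) (8 * (v * b)) (begin
      8 * a * (8 * a)                                    ≡⟨ lemma₁ a ⟩
      a * a * 64                                         ≤⟨ 64a²≤nb² ⟩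
      n * (b * b)                                        ≤⟨ *-monoˡ-≤ (b * b) (<⇒≤ hi) ⟩
      (3 + v) * (4 * (3 + v)) * (b * b)
        ≤⟨ *-monoˡ-≤ (b * b) (*-mono-≤ 3+v≤4v (*-monoʳ-≤ 4 3+v≤4v)) ⟩
      4 * v * (4 * (4 * v)) * (b * b)                    ≡⟨ lemma₂ v b ⟩
      8 * (v * b) * (8 * (v * b))                        ∎))
      where
      3+v≤4v : 3 + v ≤ 4 * v
      3+v≤4v = ≤-trans (+-monoˡ-≤ v (*-monoʳ-≤ 3 (s≤s (z≤n {u})))) (≤-reflexive (lemma₃ v))
        where
        lemma₃ : ∀ v → 3 * v + v ≡ 4 * v
        lemma₃ = solve-∀
      lemma₁ : ∀ a → 8 * a * (8 * a) ≡ a * a * 64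
      lemma₁ = solve-∀
      lemma₂ : ∀ v b → 4 * v * (4 * (4 * v)) * (b * b) ≡ 8 * (v * b) * (8 * (v * b))
      lemma₂ = solve-∀

open import Defs
open import Data.Integer.Base using (+_)
open import Data.Nat.Base using (ℕ; suc) renaming (_≥_ to _≥ℕ_)
open import Data.Product.Base using (∃-syntax; _×_; _,_)
import Data.Rational.Base as ℚ
import Data.Rational.Properties as ℚₚ
open Learning using (ε₀)
open SampleBound using (3^a≤m^b)

0<fromℚ : ∀ {q} → ℚ.0ℚ ℚ.< q → 0ℝ < fromℚ q
0<fromℚ {q} 0<q = q , 0<q , 0 , λ _ _ → ℚₚ.≤-reflexive (ℚₚ.+-identityˡ q)

corollary1p8 : ∃[ ε₀ ] (0ℝ < ε₀ ×
    (∀ (ε : ℝ) → 0ℝ < ε → ε ≤ ε₀ →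
    ∃[ c ] (0ℝ < c ×
    ∃[ n₀ ] (∀ (n : ℕ) → n ≥ℕ n₀ →
    ∀ (m : ℕ) (L : Learner n m) → Learns ε L → m ≥3^ c √ n))))
-- The constants c = 1/8 and n₀ = 36 serve every ε, which enters only through ε ≤ 1/243.
corollary1p8 = ε₀ , 0<fromℚ (ℚₚ.positive⁻¹ (+ 1 ℚ./ 243)) , λ ε _ ε≤ε₀ →
  fromℚ (+ 1 ℚ./ 8) , 0<fromℚ (ℚₚ.positive⁻¹ (+ 1 ℚ./ 8)) , 36 , λ n n≥36 m L learns a b r²≤c²n →
  3^a≤m^b {ε = ε} a (suc b) n≥36 ε≤ε₀ L learns (Reals.r²≤n/64 a b n r²≤c²n)
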